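{- For all integers $n\ge1$, $$\chi_{\mathcal{L}(\mathcal{H}_{2n-1})}(t)=\sum_{k=1}^{2n}s_D(2n,k)\,t^{k-1},$$ where $(-1)^k s_D(2n,k)$ is equal to the number of D-permutations on $[2n]$ with exactly $k$ cycles (fixed points counted as cycles).
   Context: For $n\ge 1$, the homogenized Linial arrangement $\mathcal{H}_{2n-1}$ is the set of hyperplanes $\{x_i - x_j = y_i\}$, $1 \le i < j \le n+1$, in $\mathbb{R}^{2n+1}$ with coordinates $(x_1,\dots,x_{n+1},y_1,\dots,y_n)$. Its intersection lattice $\mathcal{L}(\mathcal{H}_{2n-1})$ is the set of all intersections of subsets of these hyperplanes (the empty intersection being the whole space), ordered by reverse inclusion. For a finite ranked poset $P$ of length $\ell$ with minimum $\hat0$, Möbius function $\mu_P$ and rank function $\mathrm{rk}$, the characteristic polynomial is $\chi_P(t)=\sum_{x\in P}\mu_P(\hat0,x)t^{\ell-\mathrm{rk}(x)}$. (The lattice $\mathcal{L}(\mathcal{H}_{2n-1})$ has length $2n-1$.) A permutation $\sigma$ of $[2n]=\{1,\dots,2n\}$ is a D-permutation if $i\le\sigma(i)$ whenever $i$ is odd and $i\ge\sigma(i)$ whenever $i$ is even. -}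

module Defs where

open import Level using (0ℓ; _⊔_) renaming (suc to lsuc)
open import Data.Nat.Base as ℕ using (ℕ; zero; suc; _∸_)
import Data.Nat.Properties as ℕ
open import Data.Nat.Divisibility using (_∣_; _∣?_)
open import Data.Nat.Induction using (Acc; acc; <-wellFounded)
open import Data.Integer.Base as ℤ using (ℤ; +_; 0ℤ; 1ℤ; -1ℤ)
open import Data.Rational.Base as ℚ using (ℚ; 0ℚ; ½)
import Data.Rational.Properties as ℚ
open import Data.Fin.Base as Fin using (Fin; toℕ; inject₁; _↑ˡ_; _↑ʳ_)
import Data.Fin.Properties as Fin
open import Data.List.Base using
  (List; []; _∷_; [_]; length; map; foldr; filter; deduplicate; iterate;
   allFin; cartesianProductWith)
open import Data.List.Relation.Unary.All using (All)
import Data.List.Membership.DecPropositional as DecMembership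
import Data.List.Relation.Unary.Enumerates.Setoid as Enumerates
import Data.List.Relation.Unary.Unique.Setoid as UniqueSetoid
open import Data.Vec.Base as Vec using (Vec; lookup)
open import Data.Vec.Functional using (Vector)
open import Data.Vec.Relation.Unary.AllPairs using (allPairs?)
open import Data.Product.Base using (Σ-syntax; ∃₂; ∃-syntax; _×_; _,_; proj₁)
open import Relation.Binary.Bundles using (Poset)
open import Relation.Binary.Core using (_Preserves_⟶_)
import Relation.Binary.Construct.On as On
open import Relation.Binary.Definitions using (Decidable; Minimum)
open import Relation.Binary.PropositionalEquality using (_≡_; refl; sym; trans; cong; subst)
import Relation.Binary.Properties.Poset as PosetProperties
open import Relation.Nullary using (¬_; Dec; yes; no)
open import Relation.Nullary.Decidable using (_×-dec_; _→-dec_; ¬?)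
open import Relation.Unary as U using (Pred; _≐_)
open import Relation.Unary.Relation.Binary.Subset using (⊆-poset)

-- Real numbers: Cauchy sequences of rationals, with equality _≈ᴿ_ meaning
-- that the difference is a null sequence.  Subtraction is the only operation
-- occurring in the equations x i - x j = y i.

IsCauchy : (ℕ → ℚ) → Set
IsCauchy s = ∀ ε → 0ℚ ℚ.< ε →
  ∃[ N ] (∀ k l → N ℕ.≤ k → N ℕ.≤ l → ℚ.∣ s k ℚ.- s l ∣ ℚ.< ε)

record ℝ : Set where
  constructor mkℝ
  field
    approx : ℕ → ℚ
    cauchy : IsCauchy approx

open ℝ

infix 4 _≈ᴿ_
_≈ᴿ_ : ℝ → ℝ → Set
r ≈ᴿ s = ∀ ε → 0ℚ ℚ.< ε →
  ∃[ N ] (∀ k → N ℕ.≤ k → ℚ.∣ approx r k ℚ.- approx s k ∣ ℚ.< ε)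

private
  half : ∀ ε → ½ ℚ.* ε ℚ.+ ½ ℚ.* ε ≡ ε
  half ε = trans (sym (ℚ.*-distribʳ-+ ε ½ ½)) (ℚ.*-identityˡ ε)

  half-pos : ∀ {ε} → 0ℚ ℚ.< ε → 0ℚ ℚ.< ½ ℚ.* ε
  half-pos {ε} 0<ε = subst (ℚ._< ½ ℚ.* ε) (ℚ.*-zeroʳ ½) (ℚ.*-monoʳ-<-pos ½ 0<ε)

  rearrange : ∀ a b c d → (a ℚ.- b) ℚ.- (c ℚ.- d) ≡ (a ℚ.- c) ℚ.+ (d ℚ.- b)
  rearrange = solve 4 (λ a b c d → ((a :- b) :- (c :- d)) := ((a :- c) :+ (d :- b))) refl
    where
    open import Data.Rational.Solver using (module +-*-Solver)
    open +-*-Solver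

infixl 6 _-ᴿ_
_-ᴿ_ : ℝ → ℝ → ℝ
approx (r -ᴿ s) k = approx r k ℚ.- approx s k
cauchy (r -ᴿ s) ε 0<ε
  with cauchy r (½ ℚ.* ε) (half-pos 0<ε) | cauchy s (½ ℚ.* ε) (half-pos 0<ε)
... | M , r-close | N , s-close = M ℕ.⊔ N , close
  where
  close : ∀ k l → M ℕ.⊔ N ℕ.≤ k → M ℕ.⊔ N ℕ.≤ l →
          ℚ.∣ (approx r k ℚ.- approx s k) ℚ.- (approx r l ℚ.- approx s l) ∣ ℚ.< ε
  close k l k≥ l≥ = begin-strict
    ℚ.∣ (approx r k ℚ.- approx s k) ℚ.- (approx r l ℚ.- approx s l) ∣
      ≡⟨ cong ℚ.∣_∣ (rearrange (approx r k) (approx s k) (approx r l) (approx s l)) ⟩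
    ℚ.∣ (approx r k ℚ.- approx r l) ℚ.+ (approx s l ℚ.- approx s k) ∣
      ≤⟨ ℚ.∣p+q∣≤∣p∣+∣q∣ (approx r k ℚ.- approx r l) (approx s l ℚ.- approx s k) ⟩
    ℚ.∣ approx r k ℚ.- approx r l ∣ ℚ.+ ℚ.∣ approx s l ℚ.- approx s k ∣
      <⟨ ℚ.+-mono-< (r-close k l (ℕ.m⊔n≤o⇒m≤o M N k≥) (ℕ.m⊔n≤o⇒m≤o M N l≥))
                    (s-close l k (ℕ.m⊔n≤o⇒n≤o M N l≥) (ℕ.m⊔n≤o⇒n≤o M N k≥)) ⟩
    ½ ℚ.* ε ℚ.+ ½ ℚ.* ε
      ≡⟨ half ε ⟩
    ε ∎
    where open ℚ.≤-Reasoning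

-- ℝ^{2n+1}; the first n + 1 coordinates are the x's, the last n the y's.
Point : ℕ → Set
Point n = Vector ℝ (suc n ℕ.+ n)

x-coord : ∀ n → Point n → Fin (suc n) → ℝ
x-coord n v i = v (i ↑ˡ n)

y-coord : ∀ n → Point n → Fin n → ℝ
y-coord n v i = v (suc n ↑ʳ i)

-- The pairs i < j; as i is never the last index, it is taken in Fin n.
Index : ℕ → Set
Index n = ∃₂ λ (i : Fin n) (j : Fin (suc n)) → inject₁ i Fin.< j

hyperplane : ∀ n → Index n → Pred (Point n) 0ℓ
hyperplane n (i , j , _) v = x-coord n v (inject₁ i) -ᴿ x-coord n v j ≈ᴿ y-coord n v i

-- A subset of the (finite) arrangement is given by a list of its members;
-- ⋂ [] is the whole space.
⋂ : ∀ n → List (Index n) → Pred (Point n) 0ℓ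
⋂ n S v = All (λ e → v U.∈ hyperplane n e) S

Flat : ℕ → Set₁
Flat n = Σ[ X ∈ Pred (Point n) 0ℓ ] ∃[ S ] X ≐ ⋂ n S

points : ∀ n → Flat n → Pred (Point n) 0ℓ
points n = proj₁

-- Equality of flats is equality of subsets of ℝ^{2n+1}, and X ≤ Y means Y ⊆ X.
ℒ : (n : ℕ) → Poset (lsuc 0ℓ) 0ℓ 0ℓ
ℒ n = On.poset (PosetProperties.≥-poset (⊆-poset (Point n) 0ℓ)) (points n)

-- Polynomials in t over ℤ, as coefficient functions.  Only finite sums of
-- monomials are formed, and equality is _≗_.

Polynomial : Set
Polynomial = ℕ → ℤ

∑ℤ : List ℤ → ℤ
∑ℤ = foldr ℤ._+_ 0ℤ

∑ᵖ : List Polynomial → Polynomial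
∑ᵖ ps k = ∑ℤ (map (λ p → p k) ps)

infix 8 _·t^_
_·t^_ : ℤ → ℕ → Polynomial
(c ·t^ m) k with k ℕ.≟ m
... | yes _ = c
... | no  _ = 0ℤ

-- All the data in this record are determined by P up to _≈_ and up to the
-- order in which the elements are listed.
record FiniteRanked {a ℓ₁ ℓ₂} (P : Poset a ℓ₁ ℓ₂) (len : ℕ) : Set (a ⊔ ℓ₁ ⊔ ℓ₂) where
  open Poset P
  open PosetProperties P using (_<_; ≤-dec⇒≈-dec)

  _⋖_ : Carrier → Carrier → Set _
  x ⋖ y = x < y × (∀ z → x < z → ¬ (z < y))

  field
    _≤?_     : Decidable _≤_
    elements : List Carrier
    complete : Enumerates.IsEnumeration Eq.setoid elements
    distinct : UniqueSetoid.Unique Eq.setoid elements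

    0̂         : Carrier
    0̂-minimum : Minimum _≤_ 0̂

    rk       : Carrier → ℕ
    rk-cong  : rk Preserves _≈_ ⟶ _≡_
    rk-0̂     : rk 0̂ ≡ 0
    rk-mono  : rk Preserves _<_ ⟶ ℕ._<_
    rk-cover : ∀ {x y} → x ⋖ y → rk y ≡ suc (rk x)

    -- The longest chains have length len.
    rk-bounded  : ∀ x → rk x ℕ.≤ len
    rk-attained : ∃[ x ] rk x ≡ len

  _≟_ : Decidable _≈_
  _≟_ = ≤-dec⇒≈-dec _≤?_

  _<?_ : Decidable _<_
  x <? y = (x ≤? y) ×-dec ¬? (x ≟ y)

  -- μ x y = 1 if x ≈ y, and μ x y = - ∑_{x ≤ z < y} μ x z otherwise (an
  -- empty sum if x ≰ y).
  μ-acc : ∀ x y → Acc ℕ._<_ (rk y) → ℤ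
  μ-summand : ∀ x y → (∀ {m} → m ℕ.< rk y → Acc ℕ._<_ m) →
              ∀ z → Dec (x ≤ z × z < y) → ℤ

  μ-acc x y (acc rs) with x ≟ y
  ... | yes _ = 1ℤ
  ... | no  _ = ℤ.- ∑ℤ (map (λ z → μ-summand x y rs z ((x ≤? z) ×-dec (z <? y))) elements)

  μ-summand x y rs z (yes (_ , z<y)) = μ-acc x z (rs (rk-mono z<y))
  μ-summand x y rs z (no _)          = 0ℤ

  μ : Carrier → Carrier → ℤ
  μ x y = μ-acc x y (<-wellFounded (rk y))

  χ : Polynomial
  χ = ∑ᵖ (map (λ x → μ 0̂ x ·t^ (len ∸ rk x)) elements)

-- Permutations of [m] are given in one-line notation; i : Fin m stands for
-- the element suc (toℕ i) of [m].

words : ∀ k m → List (Vec (Fin m) k)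
words zero    m = [ Vec.[] ]
words (suc k) m = cartesianProductWith Vec._∷_ (allFin m) (words k m)

permutations : ∀ m → List (Vec (Fin m) m)
permutations m = filter (allPairs? (λ i j → ¬? (i Fin.≟ j))) (words m m)

IsD : ∀ {m} → Vec (Fin m) m → Set
IsD {m} σ = ∀ (i : Fin m) →
  (¬ (2 ∣ suc (toℕ i)) → i Fin.≤ lookup σ i) ×
  (2 ∣ suc (toℕ i) → lookup σ i Fin.≤ i)

isD? : ∀ {m} (σ : Vec (Fin m) m) → Dec (IsD σ)
isD? σ = Fin.all? λ i →
  (¬? (2 ∣? suc (toℕ i)) →-dec (i Fin.≤? lookup σ i)) ×-dec
  ((2 ∣? suc (toℕ i)) →-dec (lookup σ i Fin.≤? i))

module _ {m : ℕ} (σ : Vec (Fin m) m) where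
  open DecMembership (Fin._≟_ {m}) using (_∈_; _∈?_)

  -- j = σ^k(i) for some 0 ≤ k < m; no cycle is longer than m.
  SameCycle : Fin m → Fin m → Set
  SameCycle i j = j ∈ iterate (lookup σ) i m

  sameCycle? : Decidable SameCycle
  sameCycle? i j = j ∈? iterate (lookup σ) i m

  -- The number of classes of SameCycle.
  cycles : ℕ
  cycles = length (deduplicate sameCycle? (allFin m))

dPermutations : ∀ m → ℕ → List (Vec (Fin m) m)
dPermutations m k = filter (λ σ → isD? σ ×-dec (cycles σ ℕ.≟ k)) (permutations m)

sD : ℕ → ℕ → ℤ
sD m k = (-1ℤ ℤ.^ k) ℤ.* (+ length (dPermutations m k))

{-# OPTIONS --safe #-}
module Submission where

-- Put z i = x i - y i.  The hyperplanes become z i = x j with i < j, so this is the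
-- graphic arrangement of the bipartite graph on [2n] that joins every odd a to every
-- even b > a.  A colouring f of the vertices is constant along the edges of a flat X
-- exactly if X lies below the flat of the monochromatic edges of f, so the recursion
-- for μ gives q χ(q) = number of proper q-colourings.
--
-- On the other side, q ^ cyc σ counts the q-colourings f with f ∘ σ = f.  So up to a
-- factor q the right hand side is the sum, over all f, of (-1) ^ cyc σ over the
-- D-permutations σ that preserve f.  If f is proper, only σ = id preserves it.
-- Otherwise some colour class contains an odd a followed immediately, within that
-- class, by an even b; then σ ↦ (a b) ∘ σ is a sign reversing involution.

open import Defs
open import Algebra.Bundles using (AbelianGroup)
import Algebra.Properties.Group as Group
open import Level using (Level; 0ℓ) renaming (suc to lsuc)
open import Data.Bool.Base using (if_then_else_; true; false)
open import Data.Fin.Base as Fin using (Fin; toℕ; inject₁)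
open import Data.Fin.Permutation.Components using (transpose)
import Data.Fin.Properties as Fin
open import Data.Integer.Base as ℤ using (ℤ; +_; 0ℤ; 1ℤ; -1ℤ)
import Data.Integer.Properties as ℤ
open import Data.Integer.Tactic.RingSolver using (solve-∀)
open import Data.List.Base as List using (List; []; _∷_; _++_; map; filter; length; allFin; upTo; applyUpTo; concatMap; iterate; cartesianProductWith; deduplicate)
import Data.List.Properties as List
open import Data.List.Membership.Propositional using (_∈_; find; lose)
open import Data.List.Membership.Propositional.Properties using (∈-map⁺; ∈-map⁻; ∈-filter⁺; ∈-filter⁻; ∈-lookup; ∈-allFin; ∈-upTo⁺; ∈-concatMap⁺; ∈-cartesianProductWith⁺)
open import Data.List.Membership.Propositional.Properties.WithK using (unique∧set⇒bag)
import Data.List.Membership.Setoid as SetoidMembership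
open import Data.List.Relation.Binary.BagAndSetEquality using (∼bag⇒↭)
open import Data.List.Relation.Binary.Permutation.Propositional as ↭ using (_↭_)
open import Data.List.Relation.Binary.Permutation.Propositional.Properties using (↭-length)
open import Data.List.Relation.Unary.All as All using (All; []; _∷_; all?)
import Data.List.Relation.Unary.All.Properties as All
open import Data.List.Relation.Unary.AllPairs as AllPairs using (AllPairs; []; _∷_)
open import Data.List.Relation.Unary.Any as Any using (Any; here; there)
import Data.List.Relation.Unary.Any.Properties as Any
import Data.List.Relation.Unary.Enumerates.Setoid as Enumerates
import Data.List.Relation.Unary.Enumerates.Setoid.Properties as Enumerates
import Data.List.Relation.Unary.Unique.DecSetoid.Properties as DecSetoidUnique
open import Data.List.Relation.Unary.Unique.Propositional using (Unique)
import Data.List.Relation.Unary.Unique.Propositional.Properties as Unique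
import Data.List.Relation.Unary.Unique.Setoid as SetoidUnique
open import Data.Nat.Base as ℕ using (ℕ; zero; suc; s≤s; z≤n; NonZero; _≤_; _*_; _∸_)
open import Data.Nat.Coprimality using (1-coprimeTo) renaming (sym to coprime-sym)
open import Data.Nat.Divisibility using (_∣_; _∣?_; ∣m+n∣m⇒∣n; ∣m∣n⇒∣m+n; m∣m*n; ∣-refl; >⇒∤)
open import Data.Nat.DivMod using (_%_; _/_; m≡m%n+[m/n]*n; m%n<n)
open import Data.Nat.Induction using (Acc; acc; <-wellFounded)
import Data.Nat.Properties as ℕ
open import Data.Product.Base using (Σ-syntax; ∃-syntax; ∃₂; _×_; _,_; proj₁; proj₂; uncurry)
open import Data.Rational.Base as ℚ using (ℚ; 0ℚ; ½)
import Data.Rational.Properties as ℚ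
open import Data.Rational.Solver using (module +-*-Solver)
open import Data.Sum.Base using (_⊎_; inj₁; inj₂; [_,_]′)
open import Data.Vec.Base as Vec using (Vec)
import Data.Vec.Properties as Vec
import Data.Vec.Functional as Vector
import Data.Vec.Functional.Properties as Vector
open import Data.Vec.Relation.Unary.AllPairs using (allPairs?)
import Data.Vec.Relation.Unary.Unique.Propositional as VecUnique
import Data.Vec.Relation.Unary.Unique.Propositional.Properties as VecUnique
open import Function.Base using (_∘_; id; flip; _on_)
open import Function.Bundles using (mk⇔)
open import Function.Definitions using (Injective)
open import Relation.Binary.Bundles using (Setoid; DecSetoid; Poset)
import Relation.Binary.Construct.On as On
open import Relation.Binary.Core using (Rel)
open import Relation.Binary.Definitions using (Antisymmetric; Decidable; DecidableEquality; Reflexive; Transitive)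
open import Relation.Binary.PropositionalEquality as ≡ using (_≡_; _≢_; _≗_; refl; sym; trans; cong; cong₂; subst; subst₂; module ≡-Reasoning)
import Relation.Binary.Properties.Poset as PosetProperties
open import Relation.Nullary using (¬_; Dec; yes; no; does; contradiction)
open import Relation.Nullary.Decidable as Dec using (_×-dec_; _⊎-dec_; _→-dec_; ¬?; dec-true; dec-false)

-- Order and equality of flats are statements about sets of real points, so neither decidability nor
-- finiteness is visible from their definition. The way around this is one notion of component:
-- `rep` gives each vertex a representative, containment of flats becomes `Joined` for their graphs,
-- and the same components, taken for the graph of a permutation, are its cycles. The factor q
-- appears because the graph is connected: the lattice has length 2n - 1 although there are 2n
-- vertices, so a flat with c components contributes q ^ (c - 1) to χ(q), whereas its colourings
-- number q ^ c. Values are compared at positive q only, where this factor can be cancelled; they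
-- still determine all coefficients. The pair a, b must be adjacent in its colour class because
-- exchanging the values a and b of σ can break the D-condition only at a position strictly between
-- a and b of the same colour. The identity enters with sign (-1) ^ (2n) = 1, so the evenness of the
-- number of vertices matters.

private variable
  a b p : Level
  A B : Set a
  P Q R : Set p

-- Finite sums and indicators

∑ : List A → (A → ℤ) → ℤ
∑ xs F = ∑ℤ (map F xs)

𝟙 : Dec P → ℤ
𝟙 P? = if does P? then 1ℤ else 0ℤ

𝟙-true : (P? : Dec P) → P → 𝟙 P? ≡ 1ℤ
𝟙-true P? h = cong (if_then 1ℤ else 0ℤ) (dec-true P? h)

𝟙-false : (P? : Dec P) → ¬ P → 𝟙 P? ≡ 0ℤ
𝟙-false P? h = cong (if_then 1ℤ else 0ℤ) (dec-false P? h)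

𝟙-cong : (P? : Dec P) (Q? : Dec Q) → (P → Q) → (Q → P) → 𝟙 P? ≡ 𝟙 Q?
𝟙-cong (yes h) Q? to from = sym (𝟙-true Q? (to h))
𝟙-cong (no ¬h) Q? to from = sym (𝟙-false Q? (¬h ∘ from))

𝟙-× : (P? : Dec P) (Q? : Dec Q) → 𝟙 (P? ×-dec Q?) ≡ 𝟙 P? ℤ.* 𝟙 Q?
𝟙-× (yes _) (yes _) = refl
𝟙-× (yes _) (no _)  = refl
𝟙-× (no _)  (yes _) = refl
𝟙-× (no _)  (no _)  = refl

𝟙-⊎ : (P? : Dec P) (Q? : Dec Q) (R? : Dec R) →
      (P → Q ⊎ R) → (Q → P) → (R → P) → (Q → ¬ R) → 𝟙 P? ≡ 𝟙 Q? ℤ.+ 𝟙 R?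
𝟙-⊎ P? (yes q) (yes r) split fromQ fromR disjoint = contradiction r (disjoint q)
𝟙-⊎ P? (yes q) (no _)  split fromQ fromR disjoint = 𝟙-true P? (fromQ q)
𝟙-⊎ P? (no _)  (yes r) split fromQ fromR disjoint = 𝟙-true P? (fromR r)
𝟙-⊎ P? (no ¬q) (no ¬r) split fromQ fromR disjoint = 𝟙-false P? ([ ¬q , ¬r ]′ ∘ split)

𝟙*-cong : (P? : Dec P) {x y : ℤ} → (P → x ≡ y) → 𝟙 P? ℤ.* x ≡ 𝟙 P? ℤ.* y
𝟙*-cong (yes h) eq = cong (1ℤ ℤ.*_) (eq h)
𝟙*-cong (no _)  eq = refl

∑-cong : (xs : List A) {F G : A → ℤ} → (∀ x → F x ≡ G x) → ∑ xs F ≡ ∑ xs G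
∑-cong xs eq = cong ∑ℤ (List.map-cong eq xs)

∑-zero : (xs : List A) → ∑ xs (λ _ → 0ℤ) ≡ 0ℤ
∑-zero []       = refl
∑-zero (x ∷ xs) = trans (ℤ.+-identityˡ _) (∑-zero xs)

∑-+ : (xs : List A) (F G : A → ℤ) → ∑ xs (λ x → F x ℤ.+ G x) ≡ ∑ xs F ℤ.+ ∑ xs G
∑-+ []       F G = refl
∑-+ (x ∷ xs) F G = trans (cong (ℤ._+_ (F x ℤ.+ G x)) (∑-+ xs F G)) (interchange (F x) (G x) _ _)
  where
  interchange : ∀ i j k l → i ℤ.+ j ℤ.+ (k ℤ.+ l) ≡ i ℤ.+ k ℤ.+ (j ℤ.+ l)
  interchange = solve-∀

∑-*ˡ : (xs : List A) (c : ℤ) (F : A → ℤ) → ∑ xs (λ x → c ℤ.* F x) ≡ c ℤ.* ∑ xs F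
∑-*ˡ []       c F = sym (ℤ.*-zeroʳ c)
∑-*ˡ (x ∷ xs) c F = trans (cong (ℤ._+_ (c ℤ.* F x)) (∑-*ˡ xs c F)) (sym (ℤ.*-distribˡ-+ c (F x) _))

∑-*ʳ : (xs : List A) (F : A → ℤ) (c : ℤ) → ∑ xs (λ x → F x ℤ.* c) ≡ ∑ xs F ℤ.* c
∑-*ʳ xs F c = begin
  ∑ xs (λ x → F x ℤ.* c) ≡⟨ ∑-cong xs (λ x → ℤ.*-comm (F x) c) ⟩
  ∑ xs (λ x → c ℤ.* F x) ≡⟨ ∑-*ˡ xs c F ⟩
  c ℤ.* ∑ xs F           ≡⟨ ℤ.*-comm c _ ⟩
  ∑ xs F ℤ.* c           ∎
  where open ≡-Reasoning

∑-neg : (xs : List A) (F : A → ℤ) → ∑ xs (λ x → ℤ.- F x) ≡ ℤ.- ∑ xs F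
∑-neg []       F = refl
∑-neg (x ∷ xs) F = trans (cong (ℤ._+_ (ℤ.- F x)) (∑-neg xs F)) (sym (ℤ.neg-distrib-+ (F x) _))

∑-swap : (xs : List A) (ys : List B) (F : A → B → ℤ) →
         ∑ xs (λ x → ∑ ys (F x)) ≡ ∑ ys (λ y → ∑ xs (λ x → F x y))
∑-swap []       ys F = sym (∑-zero ys)
∑-swap (x ∷ xs) ys F = trans (cong (ℤ._+_ (∑ ys (F x))) (∑-swap xs ys F)) (sym (∑-+ ys (F x) _))

∑-map : (g : A → B) (xs : List A) (F : B → ℤ) → ∑ (map g xs) F ≡ ∑ xs (F ∘ g)
∑-map g xs F = cong ∑ℤ (sym (List.map-∘ xs))

∑-↭ : {xs ys : List A} (F : A → ℤ) → xs ↭ ys → ∑ xs F ≡ ∑ ys F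
∑-↭ F ↭.refl              = refl
∑-↭ F (↭.prep x r)         = cong (ℤ._+_ (F x)) (∑-↭ F r)
∑-↭ F (↭.swap x y r) = trans (cong (λ s → F x ℤ.+ (F y ℤ.+ s)) (∑-↭ F r)) (exchange (F x) (F y) _)
  where
  exchange : ∀ i j k → i ℤ.+ (j ℤ.+ k) ≡ j ℤ.+ (i ℤ.+ k)
  exchange = solve-∀
∑-↭ F (↭.trans r s)          = trans (∑-↭ F r) (∑-↭ F s)

∑-filter : {T : A → Set p} (T? : ∀ x → Dec (T x)) (xs : List A) (F : A → ℤ) →
           ∑ (filter T? xs) F ≡ ∑ xs (λ x → 𝟙 (T? x) ℤ.* F x)
∑-filter T? []       F = refl
∑-filter T? (x ∷ xs) F with does (T? x)
... | true  = cong₂ ℤ._+_ (sym (ℤ.*-identityˡ (F x))) (∑-filter T? xs F)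
... | false = trans (∑-filter T? xs F) (sym (trans (cong (ℤ._+ ∑ xs (λ y → 𝟙 (T? y) ℤ.* F y)) (ℤ.*-zeroˡ (F x))) (ℤ.+-identityˡ _)))

∑-length : (xs : List A) → ∑ xs (λ _ → 1ℤ) ≡ + length xs
∑-length []       = refl
∑-length (x ∷ xs) = cong (ℤ._+_ 1ℤ) (∑-length xs)

module _ {a ℓ} (S : Setoid a ℓ) (_≟_ : Decidable (Setoid._≈_ S)) where
  open Setoid S using (_≈_)
  open SetoidMembership S using () renaming (_∈_ to _∈ₛ_)

  -- Flats are listed without repetition only up to equality of point sets, hence the setoid; `∑-δ`
  -- is the version for propositional equality.
  ∑-indicator : ∀ {xs y} → SetoidUnique.Unique S xs → y ∈ₛ xs → ∑ xs (λ x → 𝟙 (x ≟ y)) ≡ 1ℤ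
  ∑-indicator {x ∷ xs} {y} (x∉ AllPairs.∷ _) (here y≈x) =
    cong₂ ℤ._+_ (𝟙-true (x ≟ y) (Setoid.sym S y≈x)) (absent x∉)
    where
    absent : ∀ {zs} → All (λ z → ¬ x ≈ z) zs → ∑ zs (λ z → 𝟙 (z ≟ y)) ≡ 0ℤ
    absent []                    = refl
    absent {z ∷ _} (x≉z ∷ x∉zs) =
      cong₂ ℤ._+_ (𝟙-false (z ≟ y) (λ z≈y → x≉z (Setoid.trans S (Setoid.sym S y≈x) (Setoid.sym S z≈y)))) (absent x∉zs)
  ∑-indicator {x ∷ xs} {y} (x∉ AllPairs.∷ xs!) (there y∈xs) =
    cong₂ ℤ._+_ (𝟙-false (x ≟ y) x≉y) (∑-indicator xs! y∈xs)
    where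
    x≉y : ¬ x ≈ y
    x≉y x≈y = All.lookupₛ S (λ z≈w x≉z x≈w → x≉z (Setoid.trans S x≈w (Setoid.sym S z≈w))) x∉ y∈xs x≈y

∑-δ : (_≟_ : DecidableEquality A) {xs : List A} {y : A} → Unique xs → y ∈ xs → (F : A → ℤ) →
      ∑ xs (λ x → 𝟙 (x ≟ y) ℤ.* F x) ≡ F y
∑-δ _≟_ {xs} {y} xs! y∈xs F = begin
  ∑ xs (λ x → 𝟙 (x ≟ y) ℤ.* F x) ≡⟨ ∑-cong xs (λ x → 𝟙*-cong (x ≟ y) (cong F)) ⟩
  ∑ xs (λ x → 𝟙 (x ≟ y) ℤ.* F y) ≡⟨ ∑-*ʳ xs _ (F y) ⟩
  ∑ xs (λ x → 𝟙 (x ≟ y)) ℤ.* F y ≡⟨ cong (ℤ._* F y) (∑-indicator (≡.setoid _) _≟_ xs! y∈xs) ⟩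
  1ℤ ℤ.* F y                     ≡⟨ ℤ.*-identityˡ (F y) ⟩
  F y                            ∎
  where open ≡-Reasoning

unique∧set⇒↭ : {xs ys : List A} → Unique xs → Unique ys →
               (∀ {z} → z ∈ xs → z ∈ ys) → (∀ {z} → z ∈ ys → z ∈ xs) → xs ↭ ys
unique∧set⇒↭ xs! ys! to from = ∼bag⇒↭ (unique∧set⇒bag xs! ys! (mk⇔ to from))

-- Enumeration of words

words-complete : ∀ {k m} (w : Vec (Fin m) k) → w ∈ words k m
words-complete Vec.[]      = here refl
words-complete (i Vec.∷ w) = ∈-cartesianProductWith⁺ Vec._∷_ (∈-allFin i) (words-complete w)

words-unique : ∀ k m → Unique (words k m)
words-unique zero    m = [] AllPairs.∷ AllPairs.[]
words-unique (suc k) m = Unique.cartesianProductWith⁺ Vec._∷_ Vec.∷-injective (Unique.allFin⁺ m) (words-unique k m)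

length-words : ∀ k m → length (words k m) ≡ m ℕ.^ k
length-words zero    m = refl
length-words (suc k) m = trans (length-product (allFin m)) (cong₂ ℕ._*_ (List.length-tabulate (id {A = Fin m})) (length-words k m))
  where
  length-product : (is : List (Fin m)) → length (cartesianProductWith Vec._∷_ is (words k m)) ≡ length is ℕ.* length (words k m)
  length-product []       = refl
  length-product (i ∷ is) = trans (List.length-++ (map (i Vec.∷_) (words k m)))
    (cong₂ ℕ._+_ (List.length-map _ (words k m)) (length-product is))

∑-involution : ∀ {k m} (φ : Vec (Fin m) k → Vec (Fin m) k) → (∀ w → φ (φ w) ≡ w) →
               (F : Vec (Fin m) k → ℤ) → ∑ (words k m) (F ∘ φ) ≡ ∑ (words k m) F
∑-involution {k} {m} φ invol F = trans (sym (∑-map φ (words k m) F)) (∑-↭ F φ-permutes)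
  where
  φ-injective : ∀ {v w} → φ v ≡ φ w → v ≡ w
  φ-injective eq = trans (sym (invol _)) (trans (cong φ eq) (invol _))
  φ-permutes : map φ (words k m) ↭ words k m
  φ-permutes = unique∧set⇒↭ (Unique.map⁺ φ-injective (words-unique k m)) (words-unique k m)
    (λ _ → words-complete _)
    (λ {w} _ → subst (_∈ _) (invol w) (∈-map⁺ φ (words-complete (φ w))))

-- Polynomials

-- A `Polynomial` is a bare coefficient function without a degree, so only its first d coefficients
-- are evaluated, by Horner's scheme. In the end d is chosen beyond all exponents that occur.
eval : ℕ → Polynomial → ℕ → ℤ
eval zero    p q = 0ℤ
eval (suc d) p q = p 0 ℤ.+ + q ℤ.* eval d (p ∘ suc) q

eval-cong : ∀ d {p r : Polynomial} q → p ≗ r → eval d p q ≡ eval d r q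
eval-cong zero    q eq = refl
eval-cong (suc d) q eq = cong₂ (λ x y → x ℤ.+ + q ℤ.* y) (eq 0) (eval-cong d q (eq ∘ suc))

eval-zero : ∀ d q → eval d (λ _ → 0ℤ) q ≡ 0ℤ
eval-zero zero    q = refl
eval-zero (suc d) q = trans (ℤ.+-identityˡ _) (trans (cong (ℤ._*_ (+ q)) (eval-zero d q)) (ℤ.*-zeroʳ (+ q)))

eval-∑ : ∀ d (xs : List A) (p : A → Polynomial) q → eval d (λ k → ∑ xs (λ x → p x k)) q ≡ ∑ xs (λ x → eval d (p x) q)
eval-∑ zero    xs p q = sym (∑-zero xs)
eval-∑ (suc d) xs p q = begin
  ∑ xs (λ x → p x 0) ℤ.+ + q ℤ.* eval d (λ k → ∑ xs (λ x → p x (suc k))) q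
    ≡⟨ cong (λ s → ∑ xs (λ x → p x 0) ℤ.+ + q ℤ.* s) (eval-∑ d xs (λ x → p x ∘ suc) q) ⟩
  ∑ xs (λ x → p x 0) ℤ.+ + q ℤ.* ∑ xs (λ x → eval d (p x ∘ suc) q)
    ≡⟨ cong (ℤ._+_ (∑ xs (λ x → p x 0))) (∑-*ˡ xs (+ q) _) ⟨
  ∑ xs (λ x → p x 0) ℤ.+ ∑ xs (λ x → + q ℤ.* eval d (p x ∘ suc) q)
    ≡⟨ ∑-+ xs (λ x → p x 0) _ ⟨
  ∑ xs (λ x → eval (suc d) (p x) q) ∎
  where open ≡-Reasoning

monomial-suc : ∀ c m k → (c ·t^ suc m) (suc k) ≡ (c ·t^ m) k
monomial-suc c m k with suc k ℕ.≟ suc m | k ℕ.≟ m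
... | yes _  | yes _  = refl
... | yes eq | no neq = contradiction (ℕ.suc-injective eq) neq
... | no neq | yes eq = contradiction (cong suc eq) neq
... | no _   | no _   = refl

raise : ∀ q c k → + q ℤ.* (c ℤ.* + (q ℕ.^ k)) ≡ c ℤ.* + (q ℕ.^ suc k)
raise q c k = trans (exchange (+ q) c (+ (q ℕ.^ k))) (cong (c ℤ.*_) (sym (ℤ.pos-* q (q ℕ.^ k))))
  where
  exchange : ∀ i j k → i ℤ.* (j ℤ.* k) ≡ j ℤ.* (i ℤ.* k)
  exchange = solve-∀

eval-monomial : ∀ c {m d} q → m ℕ.< d → eval d (c ·t^ m) q ≡ c ℤ.* + (q ℕ.^ m)
eval-monomial c {zero} {suc d} q _ = begin
  c ℤ.+ + q ℤ.* eval d ((c ·t^ 0) ∘ suc) q ≡⟨ cong (λ x → c ℤ.+ + q ℤ.* x) (eval-zero d q) ⟩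
  c ℤ.+ + q ℤ.* 0ℤ                         ≡⟨ units c (+ q) ⟩
  c ℤ.* 1ℤ                                 ∎
  where
  open ≡-Reasoning
  units : ∀ i j → i ℤ.+ j ℤ.* 0ℤ ≡ i ℤ.* 1ℤ
  units = solve-∀
eval-monomial c {suc m} {suc d} q (s≤s m<d) = begin
  0ℤ ℤ.+ + q ℤ.* eval d ((c ·t^ suc m) ∘ suc) q ≡⟨ ℤ.+-identityˡ _ ⟩
  + q ℤ.* eval d ((c ·t^ suc m) ∘ suc) q        ≡⟨ cong (ℤ._*_ (+ q)) (eval-cong d q (monomial-suc c m)) ⟩
  + q ℤ.* eval d (c ·t^ m) q                    ≡⟨ cong (ℤ._*_ (+ q)) (eval-monomial c q m<d) ⟩
  + q ℤ.* (c ℤ.* + (q ℕ.^ m))                   ≡⟨ raise q c m ⟩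
  c ℤ.* + (q ℕ.^ suc m)                         ∎
  where open ≡-Reasoning

eval-sum-of-monomials : ∀ d (xs : List A) (c : A → ℤ) (e : A → ℕ) q → All (λ x → e x ℕ.< d) xs →
  eval d (∑ᵖ (map (λ x → c x ·t^ e x) xs)) q ≡ ∑ xs (λ x → c x ℤ.* + (q ℕ.^ e x))
eval-sum-of-monomials d xs c e q e<d = begin
  eval d (∑ᵖ (map (λ x → c x ·t^ e x) xs)) q
    ≡⟨ eval-cong d q (λ k → ∑-map (λ x → c x ·t^ e x) xs (λ p → p k)) ⟩
  eval d (λ k → ∑ xs (λ x → (c x ·t^ e x) k)) q
    ≡⟨ eval-∑ d xs (λ x → c x ·t^ e x) q ⟩
  ∑ xs (λ x → eval d (c x ·t^ e x) q)
    ≡⟨ cong ∑ℤ (List.map-cong-local (All.map (λ {x} → eval-monomial (c x) q) e<d)) ⟩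
  ∑ xs (λ x → c x ℤ.* + (q ℕ.^ e x)) ∎
  where open ≡-Reasoning

-- At a point q exceeding the difference of the constant terms, q divides that
-- difference only if it vanishes.
eval-injective : ∀ d p r → (∀ q → eval d p (suc q) ≡ eval d r (suc q)) → ∀ k → k ℕ.< d → p k ≡ r k
eval-injective (suc d) p r eq = λ where
    zero    _         → p₀≡r₀
    (suc k) (s≤s k<d) → eval-injective d (p ∘ suc) (r ∘ suc) tails k k<d
  where
  open ≡-Reasoning
  δ : ℤ
  δ = p 0 ℤ.- r 0
  rearrange : ∀ a b x y q → a ℤ.+ q ℤ.* x ≡ b ℤ.+ q ℤ.* y → a ℤ.- b ≡ q ℤ.* (y ℤ.- x)
  rearrange a b x y q h = begin
    a ℤ.- b                                 ≡⟨ expand a b (q ℤ.* x) ⟩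
    (a ℤ.+ q ℤ.* x) ℤ.- b ℤ.- q ℤ.* x       ≡⟨ cong (λ s → s ℤ.- b ℤ.- q ℤ.* x) h ⟩
    (b ℤ.+ q ℤ.* y) ℤ.- b ℤ.- q ℤ.* x       ≡⟨ collect b q x y ⟩
    q ℤ.* (y ℤ.- x)                         ∎
    where
    expand : ∀ a b s → a ℤ.- b ≡ a ℤ.+ s ℤ.- b ℤ.- s
    expand = solve-∀
    collect : ∀ b q x y → b ℤ.+ q ℤ.* y ℤ.- b ℤ.- q ℤ.* x ≡ q ℤ.* (y ℤ.- x)
    collect = solve-∀
  large⇒0 : ∀ s t → s ≡ suc s * t → s ≡ 0
  large⇒0 s zero    h = trans h (ℕ.*-zeroʳ (suc s))
  large⇒0 s (suc t) h = contradiction (ℕ.≤-trans (ℕ.m≤m*n (suc s) (suc t)) (ℕ.≤-reflexive (sym h))) (ℕ.<-irrefl refl)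
  p₀≡r₀ : p 0 ≡ r 0
  p₀≡r₀ = ℤ.i-j≡0⇒i≡j (p 0) (r 0) (ℤ.∣i∣≡0⇒i≡0 (large⇒0 ℤ.∣ δ ∣ ℤ.∣ t ∣
    (trans (cong ℤ.∣_∣ (rearrange (p 0) (r 0) _ _ (+ suc ℤ.∣ δ ∣) (eq ℤ.∣ δ ∣))) (ℤ.abs-* (+ suc ℤ.∣ δ ∣) t))))
    where
    t : ℤ
    t = eval d (r ∘ suc) (suc ℤ.∣ δ ∣) ℤ.- eval d (p ∘ suc) (suc ℤ.∣ δ ∣)
  tails : ∀ q → eval d (p ∘ suc) (suc q) ≡ eval d (r ∘ suc) (suc q)
  tails q = ℤ.*-cancelˡ-≡ (+ suc q) _ _ (Group.∙-cancelˡ (AbelianGroup.group ℤ.+-0-abelianGroup) (p 0) _ _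
    (trans (eq q) (cong (λ x → x ℤ.+ + suc q ℤ.* eval d (r ∘ suc) (suc q)) (sym p₀≡r₀))))

-- Fibres of a function

-- Both `cycles` and `comps` are lengths of a deduplicated `allFin m`, so comparing such numbers
-- reduces to comparing relations.
deduplicate-cong : {R : Rel A a} {R′ : Rel A b} (R? : Decidable R) (R′? : Decidable R′) →
                   (∀ {x y} → R x y → R′ x y) → (∀ {x y} → R′ x y → R x y) →
                   ∀ xs → deduplicate R? xs ≡ deduplicate R′? xs
deduplicate-cong R? R′? to from []       = refl
deduplicate-cong {R = R} {R′ = R′} R? R′? to from (x ∷ xs) = cong (x ∷_)
  (trans (cong (filter (¬? ∘ R? x)) (deduplicate-cong R? R′? to from xs))
           (List.filter-≐ {P = λ y → ¬ R x y} {Q = λ y → ¬ R′ x y} (¬? ∘ R? x) (¬? ∘ R′? x)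
             ((λ ¬r → ¬r ∘ from) , (λ ¬r′ → ¬r′ ∘ to)) (deduplicate R′? xs)))

lookup-AllPairs-injective : {R : Rel A a} → (∀ {x y} → R x y → R y x) →
                            ∀ {xs} → AllPairs (λ x y → ¬ R x y) xs →
                            ∀ i j → R (List.lookup xs i) (List.lookup xs j) → i ≡ j
lookup-AllPairs-injective R-sym (_ ∷ _)   Fin.zero    Fin.zero    r = refl
lookup-AllPairs-injective R-sym (px ∷ _)  Fin.zero    (Fin.suc j) r = contradiction r (All.lookup px (∈-lookup j))
lookup-AllPairs-injective R-sym (px ∷ pxs) (Fin.suc i) Fin.zero   r = sym (lookup-AllPairs-injective R-sym (px ∷ pxs) Fin.zero (Fin.suc i) (R-sym r))
lookup-AllPairs-injective R-sym (_ ∷ pxs) (Fin.suc i) (Fin.suc j) r = cong Fin.suc (lookup-AllPairs-injective R-sym pxs i j r)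

module _ {m : ℕ} where

  kernel? : (g : Fin m → Fin m) → Decidable (_≡_ on g)
  kernel? g i j = g i Fin.≟ g j

  classes : (Fin m → Fin m) → List (Fin m)
  classes g = deduplicate (kernel? g) (allFin m)

  module _ (g : Fin m → Fin m) where

    private
      S : DecSetoid 0ℓ 0ℓ
      S = On.decSetoid (Fin.≡-decSetoid m) g

    classes-distinct : AllPairs (λ i j → ¬ g i ≡ g j) (classes g)
    classes-distinct = DecSetoidUnique.deduplicate-! S (allFin m)

    classes-complete : ∀ v → Any (λ i → g v ≡ g i) (classes g)
    classes-complete v = Any.deduplicate⁺ (kernel? g) (λ eq h → trans h (sym eq))
      (Any.map (cong g) (∈-allFin v))

    image : List (Fin m)
    image = map g (classes g)

    image-unique : Unique image
    image-unique = Unique-map classes-distinct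
      where
      Unique-map : ∀ {xs} → AllPairs (λ i j → ¬ g i ≡ g j) xs → Unique (map g xs)
      Unique-map []         = []
      Unique-map (px ∷ pxs) = All.map⁺ px ∷ Unique-map pxs

    ∈-image⁺ : ∀ v → g v ∈ image
    ∈-image⁺ v = Any.map⁺ (classes-complete v)

    ∈-image⁻ : ∀ {c} → c ∈ image → ∃[ v ] c ≡ g v
    ∈-image⁻ c∈ with v , _ , eq ← ∈-map⁻ g c∈ = v , eq

    length-image : length image ≡ length (classes g)
    length-image = List.length-map g (classes g)

    -- Fibres correspond to values, so any repetition-free list of exactly the values of g counts
    -- the classes. This avoids handling the chosen representatives.
    ↭-image⇒length : ∀ {cs} → Unique cs → (∀ v → g v ∈ cs) → (∀ {c} → c ∈ cs → ∃[ v ] c ≡ g v) →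
                     length cs ≡ length (classes g)
    ↭-image⇒length {cs} cs! to from = trans (↭-length cs↭image) length-image
      where
      cs↭image : cs ↭ image
      cs↭image = unique∧set⇒↭ cs! image-unique
        (λ c∈ → let v , eq = from c∈ in subst (_∈ image) (sym eq) (∈-image⁺ v))
        (λ c∈ → let v , eq = ∈-image⁻ c∈ in subst (_∈ cs) (sym eq) (to v))

  length-classes-id : length (classes id) ≡ m
  length-classes-id = trans
    (sym (↭-image⇒length id (Unique.allFin⁺ m) ∈-allFin (λ {c} _ → c , refl)))
    (List.length-tabulate (id {A = Fin m}))

-- Graphs on Fin m, given by lists of edges

merge : ∀ {m} → Fin m → Fin m → Fin m → Fin m
merge u w v = if does (v Fin.≟ w) then u else v

module _ {m : ℕ} where

  merge-≡ : (u w : Fin m) {v : Fin m} → v ≡ w → merge u w v ≡ u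
  merge-≡ u w eq = cong (if_then u else _) (dec-true (_ Fin.≟ w) eq)

  merge-≢ : (u w : Fin m) {v : Fin m} → v ≢ w → merge u w v ≡ v
  merge-≢ u w neq = cong (if_then u else _) (dec-false (_ Fin.≟ w) neq)

  merge-fixes : (u w : Fin m) → merge u w u ≡ u
  merge-fixes u w with u Fin.≟ w
  ... | yes _ = refl
  ... | no  _ = refl

  merge-avoids : {u w : Fin m} → u ≢ w → ∀ v → merge u w v ≢ w
  merge-avoids {u} {w} u≢w v eq with v Fin.≟ w
  ... | yes _   = u≢w eq
  ... | no  v≢w = v≢w eq

  Edges : Set
  Edges = List (Fin m × Fin m)

  -- A naive union-find: an edge redirects everything represented by `rep E w` to `rep E u`. Being
  -- connected is then an equality of two vertices, decidable without any mention of paths.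
  rep : Edges → Fin m → Fin m
  rep []            v = v
  rep ((u , w) ∷ E) v = merge (rep E u) (rep E w) (rep E v)

  Joined : Edges → Fin m × Fin m → Set
  Joined E (u , w) = rep E u ≡ rep E w

  joined? : ∀ E e → Dec (Joined E e)
  joined? E (u , w) = rep E u Fin.≟ rep E w

  comps : Edges → ℕ
  comps E = length (classes (rep E))

  module _ {c ℓ} (T : Setoid c ℓ) where
    open Setoid T using (Carrier; _≈_; reflexive)

    Satisfies : (Fin m → Carrier) → Fin m × Fin m → Set ℓ
    Satisfies f (u , w) = f u ≈ f w

    satisfies-rep : ∀ f {E} → All (Satisfies f) E → ∀ v → f (rep E v) ≈ f v
    satisfies-rep f []                   v = Setoid.refl T
    satisfies-rep f {(u , w) ∷ E} (fu≈fw ∷ fE) v with rep E v Fin.≟ rep E w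
    ... | no  _  = satisfies-rep f fE v
    ... | yes eq = begin
      f (rep E u) ≈⟨ satisfies-rep f fE u ⟩
      f u         ≈⟨ fu≈fw ⟩
      f w         ≈⟨ satisfies-rep f fE w ⟨
      f (rep E w) ≡⟨ cong f eq ⟨
      f (rep E v) ≈⟨ satisfies-rep f fE v ⟩
      f v         ∎
      where open import Relation.Binary.Reasoning.Setoid T

    -- The universal property of components. The setoid is arbitrary because f will be a colouring,
    -- the real labels of a point, the representatives in another graph, or the identity modulo the
    -- orbits of a permutation.
    satisfies-joined : ∀ f {E} → All (Satisfies f) E → ∀ {e} → Joined E e → Satisfies f e
    satisfies-joined f {E} fE {u , w} eq =
      trans′ (Setoid.sym T (satisfies-rep f fE u)) (trans′ (reflexive (cong f eq)) (satisfies-rep f fE w))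
      where trans′ = Setoid.trans T

  joined-self : ∀ E → All (Joined E) E
  joined-self []            = []
  joined-self ((u , w) ∷ E) =
    trans (merge-fixes (rep E u) (rep E w)) (sym (merge-≡ (rep E u) (rep E w) refl)) ∷
    All.map (cong (merge (rep E u) (rep E w))) (joined-self E)

  joined-trans : ∀ E F → All (Joined E) F → ∀ {e} → Joined F e → Joined E e
  joined-trans E F E⊨F = satisfies-joined (≡.setoid (Fin m)) (rep E) {F} E⊨F

  comps-cong : ∀ E F → All (Joined E) F → All (Joined F) E → comps E ≡ comps F
  comps-cong E F E⊨F F⊨E = cong length
    (deduplicate-cong (kernel? (rep E)) (kernel? (rep F)) (joined-trans F E F⊨E) (joined-trans E F E⊨F) (allFin m))

  comps-[] : comps [] ≡ m
  comps-[] = length-classes-id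

  comps-joined : ∀ e E → Joined E e → comps (e ∷ E) ≡ comps E
  comps-joined e E E⊨e = comps-cong (e ∷ E) E (All.tail (joined-self (e ∷ E))) (E⊨e ∷ joined-self E)

  -- Merging removes exactly one value, `rep E w`, from the image of `rep E`; putting it back in
  -- front of the new image lists the old values once each.
  comps-unjoined : ∀ e E → ¬ Joined E e → suc (comps (e ∷ E)) ≡ comps E
  comps-unjoined e@(u , w) E ¬E⊨e = begin
    suc (comps (e ∷ E))                      ≡⟨ cong suc (length-image g′) ⟨
    length (rep E w ∷ image g′)              ≡⟨ ↭-image⇒length (rep E) (w∉ ∷ image-unique g′) to from ⟩
    comps E                                  ∎
    where
    open ≡-Reasoning
    g′ : Fin m → Fin m
    g′ = rep (e ∷ E)
    w∉ : All (rep E w ≢_) (image g′)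
    w∉ = All.tabulate λ c∈ w≡c → let v , eq = ∈-image⁻ g′ c∈ in
      merge-avoids ¬E⊨e (rep E v) (sym (trans w≡c eq))
    to : ∀ v → rep E v ∈ rep E w ∷ image g′
    to v with rep E v Fin.≟ rep E w
    ... | yes eq = here eq
    ... | no neq = there (subst (_∈ image g′) (merge-≢ (rep E u) (rep E w) neq) (∈-image⁺ g′ v))
    from : ∀ {c} → c ∈ rep E w ∷ image g′ → ∃[ v ] c ≡ rep E v
    from (here eq) = w , eq
    from (there c∈) with v , eq ← ∈-image⁻ g′ c∈ with rep E v Fin.≟ rep E w
    ... | yes _ = u , eq
    ... | no _  = v , eq

  comps-++ : ∀ E F → comps (E ++ F) ℕ.≤ comps F
  comps-++ []      F = ℕ.≤-refl
  comps-++ (e ∷ E) F with joined? (E ++ F) e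
  ... | yes j = ℕ.≤-trans (ℕ.≤-reflexive (comps-joined e (E ++ F) j)) (comps-++ E F)
  ... | no ¬j = ℕ.≤-trans (ℕ.n≤1+n _) (ℕ.≤-trans (ℕ.≤-reflexive (comps-unjoined e (E ++ F) ¬j)) (comps-++ E F))

  -- If E already joins the edges of F, then E and E ++ F have the same components, and putting the
  -- edges of E in front of F one by one never raises the number of components.
  comps-antitone : ∀ E F → All (Joined E) F → comps E ℕ.≤ comps F
  comps-antitone E F E⊨F = ℕ.≤-trans
    (ℕ.≤-reflexive (comps-cong E (E ++ F) (All.++⁺ (joined-self E) E⊨F) (All.++⁻ˡ E (joined-self (E ++ F)))))
    (comps-++ E F)

  comps-connected : ∀ E → Fin m → (∀ u w → Joined E (u , w)) → comps E ≡ 1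
  comps-connected E v₀ conn = sym (↭-image⇒length (rep E) ([] ∷ []) (λ v → here (conn v v₀)) λ where
    (here eq) → v₀ , eq)

  module _ {q : ℕ} where

    Respects : Edges → Vec (Fin q) m → Set
    Respects E f = All (Satisfies (≡.setoid (Fin q)) (Vec.lookup f)) E

    respects? : ∀ E f → Dec (Respects E f)
    respects? E f = all? (λ (u , w) → Vec.lookup f u Fin.≟ Vec.lookup f w) E

    -- A colouring is constant on components, so it is determined by its
    -- restriction to a system of representatives.
    count-respecting : ∀ E → ∑ (words m q) (λ f → 𝟙 (respects? E f)) ≡ + (q ℕ.^ comps E)
    count-respecting E = begin
      ∑ (words m q) (λ f → 𝟙 (respects? E f))
        ≡⟨ ∑-cong (words m q) (λ f → ℤ.*-identityʳ _) ⟨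
      ∑ (words m q) (λ f → 𝟙 (respects? E f) ℤ.* 1ℤ)
        ≡⟨ ∑-filter (respects? E) (words m q) (λ _ → 1ℤ) ⟨
      ∑ (filter (respects? E) (words m q)) (λ _ → 1ℤ)
        ≡⟨ ∑-length (filter (respects? E) (words m q)) ⟩
      + length (filter (respects? E) (words m q))
        ≡⟨ cong +_ (↭-length (unique∧set⇒↭ (Unique.filter⁺ (respects? E) (words-unique m q))
             (Unique.map⁺ extend-injective (words-unique (comps E) q)) to from)) ⟩
      + length (map extend (words (comps E) q))
        ≡⟨ cong +_ (List.length-map extend (words (comps E) q)) ⟩
      + length (words (comps E) q)
        ≡⟨ cong +_ (length-words (comps E) q) ⟩
      + (q ℕ.^ comps E) ∎
      where
      open ≡-Reasoning
      K : List (Fin m)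
      K = classes (rep E)
      class : Fin m → Fin (comps E)
      class v = Any.index (classes-complete (rep E) v)
      extend : Vec (Fin q) (comps E) → Vec (Fin q) m
      extend w = Vec.tabulate (Vec.lookup w ∘ class)
      rep-class : ∀ v → rep E v ≡ rep E (List.lookup K (class v))
      rep-class v = Any.lookup-index (classes-complete (rep E) v)
      separated : ∀ i j → rep E (List.lookup K i) ≡ rep E (List.lookup K j) → i ≡ j
      separated = lookup-AllPairs-injective {R = _≡_ on rep E} sym (classes-distinct (rep E))
      class-lookup : ∀ i → class (List.lookup K i) ≡ i
      class-lookup i = separated _ _ (sym (rep-class (List.lookup K i)))
      class-cong : ∀ {u w} → rep E u ≡ rep E w → class u ≡ class w
      class-cong {u} {w} eq = separated _ _ (trans (sym (rep-class u)) (trans eq (rep-class w)))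
      extend-lookup : ∀ w i → Vec.lookup (extend w) (List.lookup K i) ≡ Vec.lookup w i
      extend-lookup w i = trans (Vec.lookup∘tabulate _ (List.lookup K i)) (cong (Vec.lookup w) (class-lookup i))
      extend-injective : ∀ {w w′} → extend w ≡ extend w′ → w ≡ w′
      extend-injective {w} {w′} eq = vec-ext λ i → begin
        Vec.lookup w i                              ≡⟨ extend-lookup w i ⟨
        Vec.lookup (extend w) (List.lookup K i)     ≡⟨ cong (λ x → Vec.lookup x (List.lookup K i)) eq ⟩
        Vec.lookup (extend w′) (List.lookup K i)    ≡⟨ extend-lookup w′ i ⟩
        Vec.lookup w′ i                             ∎
        where
        vec-ext : ∀ {k} {x y : Vec (Fin q) k} → (∀ i → Vec.lookup x i ≡ Vec.lookup y i) → x ≡ y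
        vec-ext {x = x} {y} h = trans (sym (Vec.tabulate∘lookup x)) (trans (Vec.tabulate-cong h) (Vec.tabulate∘lookup y))
      to : ∀ {f} → f ∈ filter (respects? E) (words m q) → f ∈ map extend (words (comps E) q)
      to {f} f∈ = subst (_∈ map extend (words (comps E) q)) eq (∈-map⁺ extend (words-complete w))
        where
        fE : Respects E f
        fE = proj₂ (∈-filter⁻ (respects? E) {xs = words m q} f∈)
        w : Vec (Fin q) (comps E)
        w = Vec.tabulate (Vec.lookup f ∘ List.lookup K)
        eq : extend w ≡ f
        eq = trans (Vec.tabulate-cong λ v → trans (Vec.lookup∘tabulate _ (class v))
               (sym (satisfies-joined (≡.setoid (Fin q)) (Vec.lookup f) fE (rep-class v))))
             (Vec.tabulate∘lookup f)
      from : ∀ {f} → f ∈ map extend (words (comps E) q) → f ∈ filter (respects? E) (words m q)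
      from f∈ with w , _ , refl ← ∈-map⁻ extend f∈ = ∈-filter⁺ (respects? E) (words-complete _)
        (All.map (λ {e} → joined⇒ e) (joined-self E))
        where
        joined⇒ : ∀ e → Joined E e → Satisfies (≡.setoid (Fin q)) (Vec.lookup (extend w)) e
        joined⇒ (u , v) eq = trans (Vec.lookup∘tabulate _ u)
          (trans (cong (Vec.lookup w) (class-cong eq)) (sym (Vec.lookup∘tabulate _ v)))

-- Cycles of permutations

iter : ∀ {m} → (Fin m → Fin m) → ℕ → Fin m → Fin m
iter τ zero    i = i
iter τ (suc k) i = τ (iter τ k i)

least : {P : ℕ → Set p} → (∀ k → Dec (P k)) → ∀ k → P k → ∃[ j ] P j × (∀ i → i ℕ.< j → ¬ P i)
least P? k Pk with P? 0
... | yes P0 = 0 , P0 , λ _ ()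
least P? zero    Pk | no ¬P0 = contradiction Pk ¬P0
least P? (suc k) Pk | no ¬P0 with j , Pj , min ← least (P? ∘ suc) k Pk =
  suc j , Pj , λ { zero _ → ¬P0 ; (suc i) (s≤s i<j) → min i i<j }

module _ {m : ℕ} where

  iter-+ : ∀ (τ : Fin m → Fin m) j k i → iter τ (j ℕ.+ k) i ≡ iter τ j (iter τ k i)
  iter-+ τ zero    k i = refl
  iter-+ τ (suc j) k i = cong τ (iter-+ τ j k i)

  iter-shift : ∀ (τ : Fin m → Fin m) k i → iter τ k (τ i) ≡ τ (iter τ k i)
  iter-shift τ zero    i = refl
  iter-shift τ (suc k) i = cong τ (iter-shift τ k i)

  iter-* : ∀ (τ : Fin m → Fin m) n p {i} → iter τ p i ≡ i → iter τ (n ℕ.* p) i ≡ i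
  iter-* τ zero    p     eq = refl
  iter-* τ (suc n) p {i} eq = trans (iter-+ τ p (n ℕ.* p) i) (trans (cong (iter τ p) (iter-* τ n p eq)) eq)

  iter-% : ∀ (τ : Fin m → Fin m) k p .{{_ : NonZero p}} {i} → iter τ p i ≡ i → iter τ k i ≡ iter τ (k % p) i
  iter-% τ k p {i} eq = begin
    iter τ k i                              ≡⟨ cong (λ l → iter τ l i) (m≡m%n+[m/n]*n k p) ⟩
    iter τ (k % p ℕ.+ k / p ℕ.* p) i        ≡⟨ iter-+ τ (k % p) _ i ⟩
    iter τ (k % p) (iter τ (k / p ℕ.* p) i) ≡⟨ cong (iter τ (k % p)) (iter-* τ (k / p) p eq) ⟩
    iter τ (k % p) i                        ∎
    where open ≡-Reasoning

  Reaches : (Fin m → Fin m) → Fin m → Fin m → Set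
  Reaches τ i j = ∃[ k ] iter τ k i ≡ j

  ∈-iterate⁺ : ∀ (τ : Fin m → Fin m) {n k} i → k ℕ.< n → iter τ k i ∈ iterate τ i n
  ∈-iterate⁺ τ {suc n} {zero}  i k<n       = here refl
  ∈-iterate⁺ τ {suc n} {suc k} i (s≤s k<n) = there (subst (_∈ _) (iter-shift τ k i) (∈-iterate⁺ τ (τ i) k<n))

  ∈-iterate⁻ : ∀ (τ : Fin m → Fin m) n {i j} → j ∈ iterate τ i n → Reaches τ i j
  ∈-iterate⁻ τ (suc n) (here eq) = 0 , sym eq
  ∈-iterate⁻ τ (suc n) {i} (there j∈) with k , eq ← ∈-iterate⁻ τ n j∈ =
    suc k , trans (sym (iter-shift τ k i)) eq

  -- The functional graph of τ. Once cycles are its components, composing with a transposition can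
  -- be studied by adding one edge.
  cycleEdges : (Fin m → Fin m) → Edges {m}
  cycleEdges τ = map (λ v → v , τ v) (allFin m)

  All-cycleEdges⁺ : ∀ {P : Fin m × Fin m → Set p} τ → (∀ v → P (v , τ v)) → All P (cycleEdges τ)
  All-cycleEdges⁺ τ h = All.map⁺ (All.tabulate λ {v} _ → h v)

  All-cycleEdges⁻ : ∀ {P : Fin m × Fin m → Set p} τ → All P (cycleEdges τ) → ∀ v → P (v , τ v)
  All-cycleEdges⁻ τ h v = All.lookup (All.map⁻ h) (∈-allFin v)

  no-visit : ∀ (τ : Fin m → Fin m) k {i j} → iter τ (suc k) i ≡ i →
             (∀ l → l ℕ.< suc k → iter τ l i ≢ j) → ¬ Reaches τ i j
  no-visit τ k period avoids (l , eq) =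
    avoids (l % suc k) (m%n<n l (suc k)) (trans (sym (iter-% τ l (suc k) period)) eq)

  module _ (τ : Fin m → Fin m) (τ-injective : Injective _≡_ _≡_ τ) where

    iter-injective : ∀ k {i j} → iter τ k i ≡ iter τ k j → i ≡ j
    iter-injective zero    eq = eq
    iter-injective (suc k) eq = iter-injective k (τ-injective eq)

    -- Pigeonhole on the first m + 1 iterates, after which injectivity cancels the common initial
    -- part. The bound by m is essential: `SameCycle` inspects only m iterates.
    period : ∀ i → ∃[ p ] suc p ℕ.≤ m × iter τ (suc p) i ≡ i
    period i with k , l , k<l , eq ← Fin.pigeonhole (ℕ.n<1+n m) (λ k → iter τ (toℕ k) i) =
      gap , gap<m , sym (iter-injective (toℕ k) (begin
        iter τ (toℕ k) i                  ≡⟨ eq ⟩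
        iter τ (toℕ l) i                  ≡⟨ cong (λ x → iter τ x i) k+gap≡l ⟨
        iter τ (toℕ k ℕ.+ suc gap) i        ≡⟨ iter-+ τ (toℕ k) (suc gap) i ⟩
        iter τ (toℕ k) (iter τ (suc gap) i) ∎))
      where
      open ≡-Reasoning
      gap : ℕ
      gap = toℕ l ℕ.∸ suc (toℕ k)
      k+gap≡l : toℕ k ℕ.+ suc gap ≡ toℕ l
      k+gap≡l = trans (ℕ.+-suc (toℕ k) gap) (ℕ.m+[n∸m]≡n k<l)
      gap<m : suc gap ℕ.≤ m
      gap<m = ℕ.≤-trans (ℕ.m≤n+m (suc gap) (toℕ k)) (ℕ.≤-trans (ℕ.≤-reflexive k+gap≡l) (ℕ.≤-pred (Fin.toℕ<n l)))

    reaches-iterate : ∀ {i j} → Reaches τ i j → j ∈ iterate τ i m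
    reaches-iterate {i} (k , refl) with p , p<m , eq ← period i =
      subst (_∈ _) (sym (iter-% τ k (suc p) eq)) (∈-iterate⁺ τ i (ℕ.≤-trans (m%n<n k (suc p)) p<m))

    reaches-sym : ∀ {i j} → Reaches τ i j → Reaches τ j i
    -- After k steps, k p further ones complete k full periods of length p + 1.
    reaches-sym {i} (k , refl) with p , _ , eq ← period i = k ℕ.* p , (begin
      iter τ (k ℕ.* p) (iter τ k i) ≡⟨ iter-+ τ (k ℕ.* p) k i ⟨
      iter τ (k ℕ.* p ℕ.+ k) i      ≡⟨ cong (λ x → iter τ x i) (trans (ℕ.+-comm (k ℕ.* p) k) (sym (ℕ.*-suc k p))) ⟩
      iter τ (k ℕ.* suc p) i        ≡⟨ iter-* τ k (suc p) eq ⟩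
      i                             ∎)
      where open ≡-Reasoning

    reaches-setoid : Setoid 0ℓ 0ℓ
    reaches-setoid = record
      { _≈_ = Reaches τ
      ; isEquivalence = record
        { refl  = 0 , refl
        ; sym   = reaches-sym
        ; trans = λ { (k , refl) (l , refl) → l ℕ.+ k , iter-+ τ l k _ }
        }
      }

    reaches⇒joined : ∀ {i j} → Reaches τ i j → Joined (cycleEdges τ) (i , j)
    reaches⇒joined {i} (zero  , refl) = refl
    reaches⇒joined {i} (suc k , refl) = trans (reaches⇒joined (k , refl))
      (All-cycleEdges⁻ {P = Joined (cycleEdges τ)} τ (joined-self (cycleEdges τ)) (iter τ k i))

    joined⇒reaches : ∀ {i j} → Joined (cycleEdges τ) (i , j) → Reaches τ i j
    joined⇒reaches {i} {j} = satisfies-joined reaches-setoid id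
      (All-cycleEdges⁺ {P = Satisfies reaches-setoid id} τ (λ v → 1 , refl)) {i , j}

  -- For an injective map on a finite set, reachability in the forward direction is already
  -- symmetric, so orbits are components of the functional graph.
  cycles-comps : ∀ σ → Injective _≡_ _≡_ (Vec.lookup σ) → cycles σ ≡ comps (cycleEdges (Vec.lookup σ))
  cycles-comps σ inj = cong length (deduplicate-cong (sameCycle? σ) (kernel? (rep (cycleEdges τ)))
    (λ h → reaches⇒joined τ inj (∈-iterate⁻ τ m h))
    (λ h → reaches-iterate τ inj (joined⇒reaches τ inj h)) (allFin m))
    where
    τ : Fin m → Fin m
    τ = Vec.lookup σ

  transpose-cases : ∀ a b (k : Fin m) →
    (k ≡ a × transpose a b k ≡ b) ⊎ (k ≡ b × transpose a b k ≡ a) ⊎ (k ≢ a × k ≢ b × transpose a b k ≡ k)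
  transpose-cases a b k with k Fin.≟ a
  ... | yes k≡a = inj₁ (k≡a , refl)
  ... | no  k≢a with k Fin.≟ b
  ...   | yes k≡b = inj₂ (inj₁ (k≡b , refl))
  ...   | no  k≢b = inj₂ (inj₂ (k≢a , k≢b , refl))

  transpose-self : ∀ a b → transpose a b a ≡ b
  transpose-self a b with transpose-cases a b a
  ... | inj₁ (_ , eq)              = eq
  ... | inj₂ (inj₁ (a≡b , eq))     = trans eq a≡b
  ... | inj₂ (inj₂ (a≢a , _ , _))  = contradiction refl a≢a

  transpose-other : ∀ a b → transpose a b b ≡ a
  transpose-other a b with transpose-cases a b b
  ... | inj₁ (b≡a , eq)            = trans eq b≡a
  ... | inj₂ (inj₁ (_ , eq))       = eq
  ... | inj₂ (inj₂ (_ , b≢b , _))  = contradiction refl b≢b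

  transpose-involutive : ∀ a b k → transpose a b (transpose a b k) ≡ k
  transpose-involutive a b k with transpose-cases a b k
  ... | inj₁ (refl , eq)          = trans (cong (transpose a b) eq) (transpose-other a b)
  ... | inj₂ (inj₁ (refl , eq))   = trans (cong (transpose a b) eq) (transpose-self a b)
  ... | inj₂ (inj₂ (_ , _ , eq))  = trans (cong (transpose a b) eq) eq

  transpose-invariant : ∀ {c} {C : Set c} (g : Fin m → C) {a b} → g a ≡ g b → ∀ k → g (transpose a b k) ≡ g k
  transpose-invariant g {a} {b} ga≡gb k with transpose-cases a b k
  ... | inj₁ (refl , eq)         = trans (cong g eq) (sym ga≡gb)
  ... | inj₂ (inj₁ (refl , eq))  = trans (cong g eq) ga≡gb
  ... | inj₂ (inj₂ (_ , _ , eq)) = cong g eq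

  module _ {τ τ′ : Fin m → Fin m} (τ-injective : Injective _≡_ _≡_ τ) {a b : Fin m} (a≢b : a ≢ b)
           (τ′≗ : ∀ v → τ′ v ≡ transpose a b (τ v)) where

    -- Follow the cycle of a until the first return k to {a , b}: up to that
    -- point τ and τ′ agree, and they arrive at different elements of {a , b}.
    separates : (Reaches τ a b × ¬ Reaches τ′ a b) ⊎ (¬ Reaches τ a b × Reaches τ′ a b)
    separates with p , _ , eq ← period τ τ-injective a
              with least (λ k → (iter τ (suc k) a Fin.≟ a) ⊎-dec (iter τ (suc k) a Fin.≟ b)) p (inj₁ eq)
    ... | k , return , first = split return
      where
      agree : ∀ l → l ℕ.< suc k → iter τ′ l a ≡ iter τ l a
      agree zero    _         = refl
      agree (suc l) (s≤s l<k) with transpose-cases a b (iter τ (suc l) a)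
      ... | inj₁ (≡a , _)             = contradiction (inj₁ ≡a) (first l l<k)
      ... | inj₂ (inj₁ (≡b , _))      = contradiction (inj₂ ≡b) (first l l<k)
      ... | inj₂ (inj₂ (_ , _ , fix)) = trans (τ′≗ _)
        (trans (cong (transpose a b ∘ τ) (agree l (ℕ.<-trans (ℕ.n<1+n l) (s≤s l<k)))) fix)
      last : iter τ′ (suc k) a ≡ transpose a b (iter τ (suc k) a)
      last = trans (τ′≗ _) (cong (transpose a b ∘ τ) (agree k (ℕ.n<1+n k)))
      avoids : ∀ l → l ℕ.< suc k → iter τ l a ≢ b
      avoids zero    _         = a≢b
      avoids (suc l) (s≤s l<k) = first l l<k ∘ inj₂
      split : iter τ (suc k) a ≡ a ⊎ iter τ (suc k) a ≡ b → _
      split (inj₁ ≡a) = inj₂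
        ( no-visit τ k ≡a avoids
        , suc k , trans last (trans (cong (transpose a b) ≡a) (transpose-self a b)))
      split (inj₂ ≡b) = inj₁
        ( (suc k , ≡b)
        , no-visit τ′ k (trans last (trans (cong (transpose a b) ≡b) (transpose-other a b)))
            (λ l l<k eq → avoids l l<k (trans (sym (agree l l<k)) eq)))

  -- Once a and b have the same representative, `rep` does not notice the transposition. The two
  -- functional graphs therefore agree after the edge from a to b is added to both.
  cycleEdges-transpose : ∀ {τ τ′ : Fin m → Fin m} {a b} → (∀ v → τ′ v ≡ transpose a b (τ v)) →
    All (Joined ((a , b) ∷ cycleEdges τ)) ((a , b) ∷ cycleEdges τ′)
  cycleEdges-transpose {τ} {τ′} {a} {b} τ′≗ with a~b ∷ E ← joined-self ((a , b) ∷ cycleEdges τ) =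
    a~b ∷ All-cycleEdges⁺ {P = Joined ((a , b) ∷ cycleEdges τ)} τ′ λ v → begin
      r v                     ≡⟨ All-cycleEdges⁻ {P = Joined ((a , b) ∷ cycleEdges τ)} τ E v ⟩
      r (τ v)                 ≡⟨ transpose-invariant r a~b (τ v) ⟨
      r (transpose a b (τ v)) ≡⟨ cong r (τ′≗ v) ⟨
      r (τ′ v)                ∎
    where
    open ≡-Reasoning
    r : Fin m → Fin m
    r = rep ((a , b) ∷ cycleEdges τ)

  swapValues : Fin m → Fin m → Vec (Fin m) m → Vec (Fin m) m
  swapValues a b = Vec.map (transpose a b)

  swapValues-involutive : ∀ a b σ → swapValues a b (swapValues a b σ) ≡ σ
  swapValues-involutive a b σ = trans (sym (Vec.map-∘ (transpose a b) (transpose a b) σ))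
    (trans (Vec.map-cong (transpose-involutive a b) σ) (Vec.map-id σ))

  lookup-swapValues : ∀ a b σ v → Vec.lookup (swapValues a b σ) v ≡ transpose a b (Vec.lookup σ v)
  lookup-swapValues a b σ v = Vec.lookup-map v (transpose a b) σ

  swapValues-injective : ∀ a b σ → Injective _≡_ _≡_ (Vec.lookup σ) → Injective _≡_ _≡_ (Vec.lookup (swapValues a b σ))
  swapValues-injective a b σ inj {v} {w} eq = inj (begin
    Vec.lookup σ v                                   ≡⟨ transpose-involutive a b _ ⟨
    transpose a b (transpose a b (Vec.lookup σ v))   ≡⟨ cong (transpose a b) (lookup-swapValues a b σ v) ⟨
    transpose a b (Vec.lookup (swapValues a b σ) v)  ≡⟨ cong (transpose a b) eq ⟩
    transpose a b (Vec.lookup (swapValues a b σ) w)  ≡⟨ cong (transpose a b) (lookup-swapValues a b σ w) ⟩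
    transpose a b (transpose a b (Vec.lookup σ w))   ≡⟨ transpose-involutive a b _ ⟩
    Vec.lookup σ w                                   ∎)
    where open ≡-Reasoning

  -- With the edge from a to b added, both functional graphs have equally many components. By
  -- `separates` that edge is redundant in exactly one of them, so the cycle numbers differ by one.
  sign-swapValues : ∀ {a b} → a ≢ b → ∀ σ → Injective _≡_ _≡_ (Vec.lookup σ) →
    -1ℤ ℤ.^ cycles (swapValues a b σ) ≡ ℤ.- (-1ℤ ℤ.^ cycles σ)
  sign-swapValues {a} {b} a≢b σ inj
    rewrite cycles-comps σ inj | cycles-comps (swapValues a b σ) (swapValues-injective a b σ inj)
    = conclude (separates inj a≢b τ′≗)
    where
    open ≡-Reasoning
    τ τ′ : Fin m → Fin m
    τ  = Vec.lookup σ
    τ′ = Vec.lookup (swapValues a b σ)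
    inj′ : Injective _≡_ _≡_ τ′
    inj′ = swapValues-injective a b σ inj
    τ′≗ : ∀ v → τ′ v ≡ transpose a b (τ v)
    τ′≗ = lookup-swapValues a b σ
    τ≗ : ∀ v → τ v ≡ transpose a b (τ′ v)
    τ≗ v = trans (sym (transpose-involutive a b (τ v))) (cong (transpose a b) (sym (τ′≗ v)))
    E E′ : Edges {m}
    E  = cycleEdges τ
    E′ = cycleEdges τ′
    same : comps ((a , b) ∷ E) ≡ comps ((a , b) ∷ E′)
    same = comps-cong ((a , b) ∷ E) ((a , b) ∷ E′) (cycleEdges-transpose τ′≗) (cycleEdges-transpose τ≗)
    conclude : (Reaches τ a b × ¬ Reaches τ′ a b) ⊎ (¬ Reaches τ a b × Reaches τ′ a b) →
               -1ℤ ℤ.^ comps E′ ≡ ℤ.- (-1ℤ ℤ.^ comps E)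
    conclude (inj₁ (r , ¬r′)) = begin
      -1ℤ ℤ.^ comps E′                     ≡⟨ cong (-1ℤ ℤ.^_) (comps-unjoined (a , b) E′ (¬r′ ∘ joined⇒reaches τ′ inj′)) ⟨
      -1ℤ ℤ.^ suc (comps ((a , b) ∷ E′))   ≡⟨ cong (λ k → -1ℤ ℤ.^ suc k) same ⟨
      -1ℤ ℤ.^ suc (comps ((a , b) ∷ E))    ≡⟨ cong (λ k → -1ℤ ℤ.^ suc k) (comps-joined (a , b) E (reaches⇒joined τ inj r)) ⟩
      -1ℤ ℤ.^ suc (comps E)                ≡⟨ ℤ.-1*i≡-i _ ⟩
      ℤ.- (-1ℤ ℤ.^ comps E)                ∎
    conclude (inj₂ (¬r , r′)) = begin
      -1ℤ ℤ.^ comps E′                          ≡⟨ cong (-1ℤ ℤ.^_) (comps-joined (a , b) E′ (reaches⇒joined τ′ inj′ r′)) ⟨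
      -1ℤ ℤ.^ comps ((a , b) ∷ E′)              ≡⟨ cong (-1ℤ ℤ.^_) same ⟨
      -1ℤ ℤ.^ comps ((a , b) ∷ E)               ≡⟨ ℤ.neg-involutive _ ⟨
      ℤ.- (ℤ.- (-1ℤ ℤ.^ comps ((a , b) ∷ E)))   ≡⟨ cong ℤ.-_ (ℤ.-1*i≡-i (-1ℤ ℤ.^ comps ((a , b) ∷ E))) ⟨
      ℤ.- (-1ℤ ℤ.^ suc (comps ((a , b) ∷ E)))   ≡⟨ cong (λ k → ℤ.- (-1ℤ ℤ.^ k)) (comps-unjoined (a , b) E (¬r ∘ joined⇒reaches τ inj)) ⟩
      ℤ.- (-1ℤ ℤ.^ comps E)                     ∎

-- Colourings and D-permutations

module _ {m : ℕ} where

  Perm : Vec (Fin m) m → Set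
  Perm = VecUnique.Unique

  perm? : ∀ σ → Dec (Perm σ)
  perm? = allPairs? (λ i j → ¬? (i Fin.≟ j))

  perm⇒injective : ∀ {σ} → Perm σ → Injective _≡_ _≡_ (Vec.lookup σ)
  perm⇒injective σ! = VecUnique.lookup-injective σ! _ _

  injective⇒perm : ∀ {σ} → Injective _≡_ _≡_ (Vec.lookup σ) → Perm σ
  injective⇒perm {σ} inj = subst Perm (Vec.tabulate∘lookup σ) (VecUnique.tabulate⁺ inj)

  Down : Fin m → Set
  Down i = 2 ∣ suc (toℕ i)

  down? : ∀ i → Dec (Down i)
  down? i = 2 ∣? suc (toℕ i)

  idᵛ : Vec (Fin m) m
  idᵛ = Vec.tabulate id

  lookup-idᵛ : ∀ v → Vec.lookup idᵛ v ≡ v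
  lookup-idᵛ = Vec.lookup∘tabulate id

  idᵛ-perm : Perm idᵛ
  idᵛ-perm = VecUnique.tabulate⁺ id

  idᵛ-isD : IsD idᵛ
  idᵛ-isD i = (λ _ → ℕ.≤-reflexive (cong toℕ (sym (lookup-idᵛ i)))) , (λ _ → ℕ.≤-reflexive (cong toℕ (lookup-idᵛ i)))

  cycles-idᵛ : cycles idᵛ ≡ m
  cycles-idᵛ = trans (cycles-comps idᵛ (perm⇒injective idᵛ-perm)) (trans
    (comps-cong (cycleEdges (Vec.lookup idᵛ)) []
      [] (All-cycleEdges⁺ {P = Joined []} (Vec.lookup idᵛ) (sym ∘ lookup-idᵛ)))
    comps-[])

  -- An orbit that only climbs must still return to its start, so antisymmetry makes it constant.
  -- The order is a parameter because odd elements climb for the usual order and even ones for its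
  -- opposite.
  monotone-cycle : {_⊑_ : Rel (Fin m) 0ℓ} → Reflexive _⊑_ → Transitive _⊑_ → Antisymmetric _≡_ _⊑_ →
    {P : Fin m → Set} (τ : Fin m → Fin m) → Injective _≡_ _≡_ τ →
    (∀ {v} → P v → P (τ v) × v ⊑ τ v) → ∀ {v} → P v → τ v ≡ v
  monotone-cycle {_⊑_} ⊑-refl ⊑-trans ⊑-antisym {P} τ inj step {v} Pv
    with p , _ , eq ← period τ inj v
    = ⊑-antisym (subst (τ v ⊑_) (trans (iter-shift τ p v) eq) (proj₂ (climb p))) (proj₂ (step Pv))
    where
    climb : ∀ k → P (iter τ k (τ v)) × τ v ⊑ iter τ k (τ v)
    climb zero    = proj₁ (step Pv) , ⊑-refl
    climb (suc k) with Q , le ← climb k = proj₁ (step Q) , ⊑-trans le (proj₂ (step Q))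

  module _ {q : ℕ} (f : Vec (Fin q) m) where

    private
      f[_] : Fin m → Fin q
      f[ v ] = Vec.lookup f v

    Proper : Set
    Proper = ∀ a b → ¬ Down a × Down b × a Fin.< b → f[ a ] ≢ f[ b ]

    proper? : Dec Proper
    proper? = Fin.all? λ a → Fin.all? λ b →
      (¬? (down? a) ×-dec down? b ×-dec (a Fin.<? b)) →-dec ¬? (f[ a ] Fin.≟ f[ b ])

    Fixes : Vec (Fin m) m → Set
    Fixes σ = ∀ v → f[ Vec.lookup σ v ] ≡ f[ v ]

    fixes? : ∀ σ → Dec (Fixes σ)
    fixes? σ = Fin.all? λ v → f[ Vec.lookup σ v ] Fin.≟ f[ v ]

    Good : Vec (Fin m) m → Set
    Good σ = (Perm σ × IsD σ) × Fixes σ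

    good? : ∀ σ → Dec (Good σ)
    good? σ = (perm? σ ×-dec isD? σ) ×-dec fixes? σ

    record Conflict (a b : Fin m) : Set where
      field
        ¬down-a   : ¬ Down a
        down-b    : Down b
        a<b       : a Fin.< b
        same      : f[ a ] ≡ f[ b ]
        adjacent  : ∀ {c} → f[ c ] ≡ f[ a ] → a Fin.< c → ¬ c Fin.< b

    -- Shrinks the interval from a to b: a vertex c of the same colour strictly inside replaces b if
    -- it is even and a if it is odd. The number n bounds b - a and decreases each time.
    conflict : ∀ n {a b} → toℕ b ℕ.≤ n ℕ.+ toℕ a → ¬ Down a → Down b → a Fin.< b → f[ a ] ≡ f[ b ] → ∃₂ Conflict
    conflict n {a} {b} gap ¬Da Db a<b fa≡fb
      with Fin.any? (λ c → (f[ c ] Fin.≟ f[ a ]) ×-dec (a Fin.<? c) ×-dec (c Fin.<? b))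
    ... | no none = a , b , record
      { ¬down-a = ¬Da ; down-b = Db ; a<b = a<b ; same = fa≡fb
      ; adjacent = λ {c} eq a<c c<b → none (c , eq , a<c , c<b) }
    conflict zero    gap _ _ a<b _ | yes _ = contradiction gap (ℕ.<⇒≱ a<b)
    conflict (suc n) {a} {b} gap ¬Da Db a<b fa≡fb | yes (c , eq , a<c , c<b) with down? c
    ... | yes Dc = conflict n (ℕ.≤-pred (ℕ.≤-trans c<b gap)) ¬Da Dc a<c (sym eq)
    ... | no ¬Dc = conflict n
      (ℕ.≤-trans gap (ℕ.≤-trans (ℕ.≤-reflexive (sym (ℕ.+-suc n (toℕ a)))) (ℕ.+-monoʳ-≤ n a<c)))
      ¬Dc Db c<b (trans eq fa≡fb)

    proper⊎conflict : Proper ⊎ ∃₂ Conflict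
    proper⊎conflict with Fin.any? (λ a → Fin.any? (λ b →
      (¬? (down? a) ×-dec down? b ×-dec (a Fin.<? b)) ×-dec (f[ a ] Fin.≟ f[ b ])))
    ... | yes (a , b , (¬Da , Db , a<b) , eq) = inj₂ (conflict (toℕ b) (ℕ.m≤m+n (toℕ b) (toℕ a)) ¬Da Db a<b eq)
    ... | no none = inj₁ λ a b h eq → none (a , b , h , eq)

    module _ {a b : Fin m} (C : Conflict a b) where
      open Conflict C

      a≢b : a ≢ b
      a≢b refl = ℕ.<-irrefl refl a<b

      -- Only positions i with σ i in {a , b} change, and such an i has the colour of a and b.
      -- Suppose σ i = a becomes b. An odd i stays fine, since i ≤ a < b. An even i satisfies a < i,
      -- the two having different parity, so adjacency gives b ≤ i. The case σ i = b is the mirror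
      -- image.
      good-swapValues : ∀ σ → Good σ → Good (swapValues a b σ)
      good-swapValues σ ((σ! , σ-D) , fixes) =
        (injective⇒perm (swapValues-injective a b σ (perm⇒injective σ!)) , D′) , fixes′
        where
        fixes′ : Fixes (swapValues a b σ)
        fixes′ v = trans (cong f[_] (lookup-swapValues a b σ v))
          (trans (transpose-invariant f[_] same (Vec.lookup σ v)) (fixes v))
        D′ : IsD (swapValues a b σ)
        D′ i rewrite lookup-swapValues a b σ i with σ-D i | fixes i | transpose-cases a b (Vec.lookup σ i)
        ... | up , down | fix | inj₂ (inj₂ (_ , _ , eq)) rewrite eq = up , down
        ... | up , down | fix | inj₁ (σi≡a , eq) rewrite eq | σi≡a =
          (λ ¬Di → ℕ.≤-trans (up ¬Di) (ℕ.<⇒≤ a<b)) ,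
          (λ Di → ℕ.≮⇒≥ (adjacent (sym fix) (Fin.≤∧≢⇒< (down Di) λ { refl → ¬down-a Di })))
        ... | up , down | fix | inj₂ (inj₁ (σi≡b , eq)) rewrite eq | σi≡b =
          (λ ¬Di → ℕ.≮⇒≥ λ a<i → adjacent (trans (sym fix) (sym same)) a<i
            (Fin.≤∧≢⇒< (up ¬Di) λ { refl → ¬Di down-b })) ,
          (λ Di → ℕ.≤-trans (ℕ.<⇒≤ a<b) (down Di))

    -- If σ moved an odd v to an even element, or an even v to an odd one, then v and σ v would be
    -- adjacent in the graph and yet have the same colour. So σ preserves parity, odd elements never
    -- descend and even ones never rise, and `monotone-cycle` applies to each kind.
    proper⇒id : Proper → ∀ {σ} → Good σ → σ ≡ idᵛ
    proper⇒id proper {σ} ((σ! , σ-D) , fixes) = trans (sym (Vec.tabulate∘lookup σ)) (Vec.tabulate-cong fixed)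
      where
      τ : Fin m → Fin m
      τ = Vec.lookup σ
      up-stays : ∀ {v} → ¬ Down v → ¬ Down (τ v) × v Fin.≤ τ v
      up-stays {v} ¬Dv = stays , v≤τv
        where
        v≤τv : v Fin.≤ τ v
        v≤τv = proj₁ (σ-D v) ¬Dv
        stays : ¬ Down (τ v)
        stays Dτv = proper v (τ v) (¬Dv , Dτv , Fin.≤∧≢⇒< v≤τv λ eq → ¬Dv (subst Down (sym eq) Dτv)) (sym (fixes v))
      down-stays : ∀ {v} → Down v → Down (τ v) × τ v Fin.≤ v
      down-stays {v} Dv with down? (τ v) | proj₂ (σ-D v) Dv
      ... | yes Dτv | τv≤v = Dτv , τv≤v
      ... | no ¬Dτv | τv≤v = contradiction (fixes v)
        (proper (τ v) v (¬Dτv , Dv , Fin.≤∧≢⇒< τv≤v λ eq → ¬Dτv (subst Down (sym eq) Dv)))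
      fixed : ∀ v → τ v ≡ v
      fixed v with down? v
      ... | no ¬Dv = monotone-cycle {Fin._≤_} Fin.≤-refl Fin.≤-trans Fin.≤-antisym τ (perm⇒injective σ!) up-stays ¬Dv
      ... | yes Dv = monotone-cycle {flip Fin._≤_} Fin.≤-refl (flip Fin.≤-trans) (flip Fin.≤-antisym) τ (perm⇒injective σ!) down-stays Dv

    good-idᵛ : Good idᵛ
    good-idᵛ = (idᵛ-perm , idᵛ-isD) , λ v → cong f[_] (lookup-idᵛ v)

    i≡-i⇒i≡0 : ∀ {i} → i ≡ ℤ.- i → i ≡ 0ℤ
    i≡-i⇒i≡0 {ℤ.+0}       eq = refl

    -- The hypothesis is the sign of the identity, which has m cycles and is the sole survivor for a
    -- proper f. In the other case the sum equals its own negative.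
    signed-count : -1ℤ ℤ.^ m ≡ 1ℤ →
      ∑ (words m m) (λ σ → 𝟙 (good? σ) ℤ.* -1ℤ ℤ.^ cycles σ) ≡ 𝟙 proper?
    signed-count even with proper⊎conflict
    ... | inj₁ proper = begin
      ∑ (words m m) (λ σ → 𝟙 (good? σ) ℤ.* -1ℤ ℤ.^ cycles σ)
        ≡⟨ ∑-cong (words m m) (λ σ → cong (ℤ._* -1ℤ ℤ.^ cycles σ)
             (𝟙-cong (good? σ) (σ ≟ᵛ idᵛ) (proper⇒id proper) λ { refl → good-idᵛ })) ⟩
      ∑ (words m m) (λ σ → 𝟙 (σ ≟ᵛ idᵛ) ℤ.* -1ℤ ℤ.^ cycles σ)
        ≡⟨ ∑-δ _≟ᵛ_ (words-unique m m) (words-complete idᵛ) (λ σ → -1ℤ ℤ.^ cycles σ) ⟩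
      -1ℤ ℤ.^ cycles idᵛ
        ≡⟨ cong (-1ℤ ℤ.^_) cycles-idᵛ ⟩
      -1ℤ ℤ.^ m
        ≡⟨ even ⟩
      1ℤ
        ≡⟨ 𝟙-true proper? proper ⟨
      𝟙 proper? ∎
      where
      open ≡-Reasoning
      _≟ᵛ_ : DecidableEquality (Vec (Fin m) m)
      _≟ᵛ_ = Vec.≡-dec Fin._≟_
    ... | inj₂ (a , b , C) = trans (i≡-i⇒i≡0 (begin
      ∑ (words m m) weight                       ≡⟨ ∑-involution (swapValues a b) (swapValues-involutive a b) weight ⟨
      ∑ (words m m) (weight ∘ swapValues a b)    ≡⟨ ∑-cong (words m m) weight-swapValues ⟩
      ∑ (words m m) (λ σ → ℤ.- weight σ)         ≡⟨ ∑-neg (words m m) weight ⟩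
      ℤ.- ∑ (words m m) weight                   ∎))
      (sym (𝟙-false proper? λ proper → proper a b (¬down-a , down-b , a<b) same))
      where
      open ≡-Reasoning
      open Conflict C
      weight : Vec (Fin m) m → ℤ
      weight σ = 𝟙 (good? σ) ℤ.* -1ℤ ℤ.^ cycles σ
      weight-swapValues : ∀ σ → weight (swapValues a b σ) ≡ ℤ.- weight σ
      weight-swapValues σ = begin
        𝟙 (good? (swapValues a b σ)) ℤ.* -1ℤ ℤ.^ cycles (swapValues a b σ)
          ≡⟨ cong (ℤ._* -1ℤ ℤ.^ cycles (swapValues a b σ)) (𝟙-cong (good? (swapValues a b σ)) (good? σ)
               (λ g → subst Good (swapValues-involutive a b σ) (good-swapValues C (swapValues a b σ) g))
               (good-swapValues C σ)) ⟩
        𝟙 (good? σ) ℤ.* -1ℤ ℤ.^ cycles (swapValues a b σ)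
          ≡⟨ 𝟙*-cong (good? σ) (λ { ((σ! , _) , _) → sign-swapValues (a≢b C) σ (perm⇒injective σ!) }) ⟩
        𝟙 (good? σ) ℤ.* ℤ.- (-1ℤ ℤ.^ cycles σ)
          ≡⟨ ℤ.neg-distribʳ-* (𝟙 (good? σ)) (-1ℤ ℤ.^ cycles σ) ⟨
        ℤ.- weight σ ∎

  count-fixing : ∀ {q} σ → Perm σ → ∑ (words m q) (λ f → 𝟙 (fixes? f σ)) ≡ + (q ℕ.^ cycles σ)
  count-fixing {q} σ σ! = begin
    ∑ (words m q) (λ f → 𝟙 (fixes? f σ))
      ≡⟨ ∑-cong (words m q) (λ f → 𝟙-cong (fixes? f σ) (respects? E f)
           (λ h → All-cycleEdges⁺ {P = λ e → Vec.lookup f (proj₁ e) ≡ Vec.lookup f (proj₂ e)} τ (sym ∘ h))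
           (λ h v → sym (All-cycleEdges⁻ {P = λ e → Vec.lookup f (proj₁ e) ≡ Vec.lookup f (proj₂ e)} τ h v))) ⟩
    ∑ (words m q) (λ f → 𝟙 (respects? E f))
      ≡⟨ count-respecting E ⟩
    + (q ℕ.^ comps E)
      ≡⟨ cong (λ k → + (q ℕ.^ k)) (cycles-comps σ (perm⇒injective σ!)) ⟨
    + (q ℕ.^ cycles σ) ∎
    where
    open ≡-Reasoning
    τ : Fin m → Fin m
    τ = Vec.lookup σ
    E : Edges {m}
    E = cycleEdges τ

  count-proper : ∀ q → -1ℤ ℤ.^ m ≡ 1ℤ →
    ∑ (words m q) (λ f → 𝟙 (proper? f)) ≡
    ∑ (words m m) (λ σ → 𝟙 (perm? σ ×-dec isD? σ) ℤ.* (-1ℤ ℤ.^ cycles σ ℤ.* + (q ℕ.^ cycles σ)))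
  count-proper q even = begin
    ∑ (words m q) (λ f → 𝟙 (proper? f))
      ≡⟨ ∑-cong (words m q) (λ f → signed-count f even) ⟨
    ∑ (words m q) (λ f → ∑ (words m m) (λ σ → 𝟙 (good? f σ) ℤ.* -1ℤ ℤ.^ cycles σ))
      ≡⟨ ∑-swap (words m q) (words m m) _ ⟩
    ∑ (words m m) (λ σ → ∑ (words m q) (λ f → 𝟙 (good? f σ) ℤ.* -1ℤ ℤ.^ cycles σ))
      ≡⟨ ∑-cong (words m m) inner ⟩
    ∑ (words m m) (λ σ → 𝟙 (perm? σ ×-dec isD? σ) ℤ.* (-1ℤ ℤ.^ cycles σ ℤ.* + (q ℕ.^ cycles σ))) ∎
    where
    open ≡-Reasoning
    rearrange : ∀ i j k → i ℤ.* j ℤ.* k ≡ i ℤ.* (k ℤ.* j)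
    rearrange = solve-∀
    inner : ∀ σ → ∑ (words m q) (λ f → 𝟙 (good? f σ) ℤ.* -1ℤ ℤ.^ cycles σ) ≡
                  𝟙 (perm? σ ×-dec isD? σ) ℤ.* (-1ℤ ℤ.^ cycles σ ℤ.* + (q ℕ.^ cycles σ))
    inner σ = begin
      ∑ (words m q) (λ f → 𝟙 (good? f σ) ℤ.* s)
        ≡⟨ ∑-cong (words m q) (λ f → trans (cong (ℤ._* s) (𝟙-× (perm? σ ×-dec isD? σ) (fixes? f σ))) (rearrange d (𝟙 (fixes? f σ)) s)) ⟩
      ∑ (words m q) (λ f → d ℤ.* (s ℤ.* 𝟙 (fixes? f σ)))
        ≡⟨ trans (∑-*ˡ (words m q) d _) (cong (d ℤ.*_) (∑-*ˡ (words m q) s _)) ⟩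
      d ℤ.* (s ℤ.* ∑ (words m q) (λ f → 𝟙 (fixes? f σ)))
        ≡⟨ 𝟙*-cong (perm? σ ×-dec isD? σ) (λ h → cong (s ℤ.*_) (count-fixing σ (proj₁ h))) ⟩
      d ℤ.* (s ℤ.* + (q ℕ.^ cycles σ)) ∎
      where
      d s : ℤ
      d = 𝟙 (perm? σ ×-dec isD? σ)
      s = -1ℤ ℤ.^ cycles σ

-- The Möbius function

module _ {a ℓ₁ ℓ₂ len} {P : Poset a ℓ₁ ℓ₂} (F : FiniteRanked P len) where
  open Poset P using (Carrier; _≈_; antisym; module Eq) renaming (_≤_ to _⊑_; trans to ≤-trans; reflexive to ≤-reflexive)
  open PosetProperties P using (_<_)
  open FiniteRanked F

  -- The recursive calls of `μ-acc` carry accessibility proofs inherited from y. Only independence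
  -- of these proofs lets `μ` itself appear on the right of the recursion in `μ-≉`.
  μ-acc-irrelevant : ∀ x y (r s : Acc ℕ._<_ (rk y)) → μ-acc x y r ≡ μ-acc x y s
  μ-summand-irrelevant : ∀ x y (r s : ∀ {m} → m ℕ.< rk y → Acc ℕ._<_ m) z d → μ-summand x y r z d ≡ μ-summand x y s z d

  μ-acc-irrelevant x y (acc r) (acc s) with x ≟ y
  ... | yes _ = refl
  ... | no _  = cong ℤ.-_ (∑-cong elements λ z → μ-summand-irrelevant x y r s z ((x ≤? z) ×-dec (z <? y)))

  μ-summand-irrelevant x y r s z (yes (_ , z<y)) = μ-acc-irrelevant x z (r (rk-mono z<y)) (s (rk-mono z<y))
  μ-summand-irrelevant x y r s z (no _)          = refl

  μ-acc-≈ : ∀ {x y} (r : Acc ℕ._<_ (rk y)) → x ≈ y → μ-acc x y r ≡ 1ℤ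
  μ-acc-≈ {x} {y} (acc r) x≈y with x ≟ y
  ... | yes _  = refl
  ... | no x≉y = contradiction x≈y x≉y

  μ-acc-≉ : ∀ {x y} (r : Acc ℕ._<_ (rk y)) → ¬ x ≈ y →
            μ-acc x y r ≡ ℤ.- ∑ elements (λ z → 𝟙 ((x ≤? z) ×-dec (z <? y)) ℤ.* μ x z)
  μ-acc-≉ {x} {y} (acc r) x≉y with x ≟ y
  ... | yes x≈y = contradiction x≈y x≉y
  ... | no _    = cong ℤ.-_ (∑-cong elements λ z → summand z ((x ≤? z) ×-dec (z <? y)))
    where
    summand : ∀ z d → μ-summand x y r z d ≡ 𝟙 d ℤ.* μ x z
    summand z (yes (_ , z<y)) = trans
      (μ-acc-irrelevant x z (r (rk-mono z<y)) (<-wellFounded (rk z))) (sym (ℤ.*-identityˡ (μ x z)))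
    summand z (no _)          = sym (ℤ.*-zeroˡ (μ x z))

  μ-≈ : ∀ {x y} → x ≈ y → μ x y ≡ 1ℤ
  μ-≈ {y = y} = μ-acc-≈ (<-wellFounded (rk y))

  μ-≉ : ∀ {x y} → ¬ x ≈ y → μ x y ≡ ℤ.- ∑ elements (λ z → 𝟙 ((x ≤? z) ×-dec (z <? y)) ℤ.* μ x z)
  μ-≉ {y = y} = μ-acc-≉ (<-wellFounded (rk y))

  private
    ≤⇒<⊎≈ : ∀ {z y} → z ⊑ y → z < y ⊎ z ≈ y
    ≤⇒<⊎≈ {z} {y} z≤y with z ≟ y
    ... | yes z≈y = inj₂ z≈y
    ... | no  z≉y = inj₁ (z≤y , z≉y)

    𝟙-≤ : ∀ z y → 𝟙 (z ≤? y) ≡ 𝟙 (z <? y) ℤ.+ 𝟙 (z ≟ y)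
    𝟙-≤ z y = 𝟙-⊎ (z ≤? y) (z <? y) (z ≟ y) ≤⇒<⊎≈ proj₁ ≤-reflexive proj₂

    <-respʳ : ∀ {w y z} → y ≈ z → w < y → w < z
    <-respʳ y≈z (w≤y , w≉y) = ≤-trans w≤y (≤-reflexive y≈z) , λ w≈z → w≉y (Eq.trans w≈z (Eq.sym y≈z))

  -- Away from the minimum, the terms strictly below y add up to M, and the recursion gives -M at y
  -- itself. The listed copy of y is only `≈` to y, so `top` computes the value there by comparing
  -- the strict down-sets. At the minimum, only its own copy contributes.
  ∑-μ-below : ∀ y → ∑ elements (λ z → 𝟙 (z ≤? y) ℤ.* μ 0̂ z) ≡ 𝟙 (y ≟ 0̂)
  ∑-μ-below y with y ≟ 0̂
  ... | yes y≈0̂ = trans (∑-cong elements term) (∑-indicator Eq.setoid _≟_ distinct (complete y))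
    where
    0̂≈ : ∀ {z} → z ⊑ y → 0̂ ≈ z
    0̂≈ z≤y = antisym (0̂-minimum _) (≤-trans z≤y (≤-reflexive y≈0̂))
    term : ∀ z → 𝟙 (z ≤? y) ℤ.* μ 0̂ z ≡ 𝟙 (z ≟ y)
    term z = trans (𝟙*-cong (z ≤? y) (λ z≤y → μ-≈ (0̂≈ z≤y))) (trans (ℤ.*-identityʳ _)
      (𝟙-cong (z ≤? y) (z ≟ y) (λ z≤y → Eq.trans (Eq.sym (0̂≈ z≤y)) (Eq.sym y≈0̂)) ≤-reflexive))
  ... | no y≉0̂ = begin
    ∑ elements (λ z → 𝟙 (z ≤? y) ℤ.* μ 0̂ z)
      ≡⟨ ∑-cong elements (λ z → trans (cong (ℤ._* μ 0̂ z) (𝟙-≤ z y)) (ℤ.*-distribʳ-+ (μ 0̂ z) (𝟙 (z <? y)) (𝟙 (z ≟ y)))) ⟩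
    ∑ elements (λ z → 𝟙 (z <? y) ℤ.* μ 0̂ z ℤ.+ 𝟙 (z ≟ y) ℤ.* μ 0̂ z)
      ≡⟨ ∑-+ elements _ _ ⟩
    M ℤ.+ ∑ elements (λ z → 𝟙 (z ≟ y) ℤ.* μ 0̂ z)
      ≡⟨ cong (ℤ._+_ M) (∑-cong elements (λ z → 𝟙*-cong (z ≟ y) (top z))) ⟩
    M ℤ.+ ∑ elements (λ z → 𝟙 (z ≟ y) ℤ.* ℤ.- M)
      ≡⟨ cong (ℤ._+_ M) (∑-*ʳ elements _ (ℤ.- M)) ⟩
    M ℤ.+ ∑ elements (λ z → 𝟙 (z ≟ y)) ℤ.* ℤ.- M
      ≡⟨ cong (λ s → M ℤ.+ s ℤ.* ℤ.- M) (∑-indicator Eq.setoid _≟_ distinct (complete y)) ⟩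
    M ℤ.+ 1ℤ ℤ.* ℤ.- M
      ≡⟨ cancel M ⟩
    0ℤ ∎
    where
    open ≡-Reasoning
    M : ℤ
    M = ∑ elements (λ z → 𝟙 (z <? y) ℤ.* μ 0̂ z)
    cancel : ∀ i → i ℤ.+ 1ℤ ℤ.* ℤ.- i ≡ 0ℤ
    cancel = solve-∀
    top : ∀ z → z ≈ y → μ 0̂ z ≡ ℤ.- M
    top z z≈y = trans (μ-≉ λ 0̂≈z → y≉0̂ (Eq.sym (Eq.trans 0̂≈z z≈y)))
      (cong ℤ.-_ (∑-cong elements λ w → cong (ℤ._* μ 0̂ w)
        (𝟙-cong ((0̂ ≤? w) ×-dec (w <? z)) (w <? y)
          (λ h → <-respʳ z≈y (proj₂ h))
          (λ w<y → 0̂-minimum w , <-respʳ (Eq.sym z≈y) w<y))))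

-- Real numbers

open ℝ

private
  ∣p-p∣≡0 : ∀ p → ℚ.∣ p ℚ.- p ∣ ≡ 0ℚ
  ∣p-p∣≡0 p = cong ℚ.∣_∣ (ℚ.+-inverseʳ p)

  ∣p-q∣≡∣q-p∣ : ∀ p q → ℚ.∣ p ℚ.- q ∣ ≡ ℚ.∣ q ℚ.- p ∣
  ∣p-q∣≡∣q-p∣ p q = trans (sym (ℚ.∣-p∣≡∣p∣ (p ℚ.- q))) (cong ℚ.∣_∣ (negate p q))
    where
    open +-*-Solver
    negate : ∀ p q → ℚ.- (p ℚ.- q) ≡ q ℚ.- p
    negate = solve 2 (λ p q → :- (p :- q) := q :- p) refl

  ∣p-r∣≤∣p-q∣+∣q-r∣ : ∀ p q r → ℚ.∣ p ℚ.- r ∣ ℚ.≤ ℚ.∣ p ℚ.- q ∣ ℚ.+ ℚ.∣ q ℚ.- r ∣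
  ∣p-r∣≤∣p-q∣+∣q-r∣ p q r = subst (λ x → ℚ.∣ x ∣ ℚ.≤ ℚ.∣ p ℚ.- q ∣ ℚ.+ ℚ.∣ q ℚ.- r ∣) (sym (telescope p q r))
    (ℚ.∣p+q∣≤∣p∣+∣q∣ (p ℚ.- q) (q ℚ.- r))
    where
    open +-*-Solver
    telescope : ∀ p q r → p ℚ.- r ≡ (p ℚ.- q) ℚ.+ (q ℚ.- r)
    telescope = solve 3 (λ p q r → p :- r := (p :- q) :+ (q :- r)) refl

  ½ε+½ε≡ε : ∀ ε → ½ ℚ.* ε ℚ.+ ½ ℚ.* ε ≡ ε
  ½ε+½ε≡ε ε = trans (sym (ℚ.*-distribʳ-+ ε ½ ½)) (ℚ.*-identityˡ ε)

  0<½ε : ∀ {ε} → 0ℚ ℚ.< ε → 0ℚ ℚ.< ½ ℚ.* ε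
  0<½ε {ε} 0<ε = subst (ℚ._< ½ ℚ.* ε) (ℚ.*-zeroʳ ½) (ℚ.*-monoʳ-<-pos ½ 0<ε)

pointwise⇒≈ᴿ : ∀ r s → (∀ k → approx r k ≡ approx s k) → r ≈ᴿ s
pointwise⇒≈ᴿ r s eq ε 0<ε = 0 , λ k _ →
  subst (ℚ._< ε) (sym (trans (cong (λ x → ℚ.∣ approx r k ℚ.- x ∣) (sym (eq k))) (∣p-p∣≡0 (approx r k)))) 0<ε

≈ᴿ-sym : ∀ r s → r ≈ᴿ s → s ≈ᴿ r
≈ᴿ-sym r s r≈s ε 0<ε with N , close ← r≈s ε 0<ε =
  N , λ k N≤k → subst (ℚ._< ε) (∣p-q∣≡∣q-p∣ (approx r k) (approx s k)) (close k N≤k)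

≈ᴿ-trans : ∀ r s t → r ≈ᴿ s → s ≈ᴿ t → r ≈ᴿ t
≈ᴿ-trans r s t r≈s s≈t ε 0<ε
  with M , close₁ ← r≈s (½ ℚ.* ε) (0<½ε 0<ε) | N , close₂ ← s≈t (½ ℚ.* ε) (0<½ε 0<ε) =
  M ℕ.⊔ N , λ k k≥ → begin-strict
    ℚ.∣ approx r k ℚ.- approx t k ∣
      ≤⟨ ∣p-r∣≤∣p-q∣+∣q-r∣ (approx r k) (approx s k) (approx t k) ⟩
    ℚ.∣ approx r k ℚ.- approx s k ∣ ℚ.+ ℚ.∣ approx s k ℚ.- approx t k ∣
      <⟨ ℚ.+-mono-< (close₁ k (ℕ.m⊔n≤o⇒m≤o M N k≥)) (close₂ k (ℕ.m⊔n≤o⇒n≤o M N k≥)) ⟩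
    ½ ℚ.* ε ℚ.+ ½ ℚ.* ε
      ≡⟨ ½ε+½ε≡ε ε ⟩
    ε ∎
  where open ℚ.≤-Reasoning

ℝ-setoid : Setoid 0ℓ 0ℓ
ℝ-setoid = record
  { Carrier = ℝ
  ; _≈_ = _≈ᴿ_
  ; isEquivalence = record
    { refl  = λ {r} → pointwise⇒≈ᴿ r r (λ _ → refl)
    ; sym   = λ {r} {s} → ≈ᴿ-sym r s
    ; trans = λ {r} {s} {t} → ≈ᴿ-trans r s t
    }
  }

constᴿ : ℚ → ℝ
constᴿ p = mkℝ (λ _ → p) λ ε 0<ε → 0 , λ _ _ _ _ → subst (ℚ._< ε) (sym (∣p-p∣≡0 p)) 0<ε

constᴿ-injective : ∀ {p q} → constᴿ p ≈ᴿ constᴿ q → p ≡ q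
constᴿ-injective {p} {q} p≈q with ℚ.∣ p ℚ.- q ∣ ℚ.≟ 0ℚ
... | yes eq = p-q≡0⇒p≡q (ℚ.∣p∣≡0⇒p≡0 (p ℚ.- q) eq)
  where
  open +-*-Solver
  p-q≡0⇒p≡q : p ℚ.- q ≡ 0ℚ → p ≡ q
  p-q≡0⇒p≡q eq = trans (solve 2 (λ p q → p := (p :- q) :+ q) refl p q) (trans (cong (ℚ._+ q) eq) (ℚ.+-identityˡ q))
-- The tolerance is the distance of p and q itself; the two constant sequences would have to come
-- closer than they are.
... | no neq with N , close ← p≈q ℚ.∣ p ℚ.- q ∣ (ℚ.≰⇒> λ ≤0 → neq (ℚ.≤-antisym ≤0 (ℚ.0≤∣p∣ (p ℚ.- q)))) =
  contradiction (close N ℕ.≤-refl) (ℚ.<-irrefl refl)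

-- Given directly in lowest terms (the field 0 is the denominator minus one), so that injectivity is
-- read off the numerator.
fromℕ : ℕ → ℚ
fromℕ k = ℚ.mkℚ (+ k) 0 (coprime-sym (1-coprimeTo k))

fromℕ-injective : ∀ {k l} → fromℕ k ≡ fromℕ l → k ≡ l
fromℕ-injective eq = ℤ.+-injective (cong ℚ.numerator eq)

-- Separates the variables: x i - x j = y i becomes x i - y i = x j, each side depending on a single
-- vertex. Exchanging the roles of s and t gives the way back.
≈ᴿ-move : ∀ r s t → r -ᴿ s ≈ᴿ t → r -ᴿ t ≈ᴿ s
≈ᴿ-move r s t h ε 0<ε with N , close ← h ε 0<ε = N , λ k N≤k →
  subst (ℚ._< ε) (cong ℚ.∣_∣ (exchange (approx r k) (approx s k) (approx t k))) (close k N≤k)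
  where
  open +-*-Solver
  exchange : ∀ p q r → (p ℚ.- q) ℚ.- r ≡ (p ℚ.- r) ℚ.- q
  exchange = solve 3 (λ p q r → (p :- q) :- r := (p :- r) :- q) refl

-- Flats of the arrangement

-- With indices counted from 0, the vertex 2 i stands for x i - y i and the vertex
-- 2 i + 1 for x (i + 1); the coordinate x 0 occurs in no equation.

module _ {n : ℕ} where

  vertex : Fin n → Fin 2 → Fin (2 * n)
  vertex i b = Fin.cast (ℕ.*-comm n 2) (Fin.combine i b)

  coords : Fin (2 * n) → Fin n × Fin 2
  coords v = Fin.remQuot 2 (Fin.cast (ℕ.*-comm 2 n) v)

  coords-vertex : ∀ i b → coords (vertex i b) ≡ (i , b)
  coords-vertex i b = trans (cong (Fin.remQuot 2) (Fin.cast-involutive (ℕ.*-comm 2 n) (ℕ.*-comm n 2) (Fin.combine i b)))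
    (Fin.remQuot-combine i b)

  vertex-coords : ∀ v → uncurry vertex (coords v) ≡ v
  vertex-coords v = trans (cong (Fin.cast (ℕ.*-comm n 2)) (Fin.combine-remQuot {n} 2 (Fin.cast (ℕ.*-comm 2 n) v)))
    (Fin.cast-involutive (ℕ.*-comm n 2) (ℕ.*-comm 2 n) v)

  toℕ-vertex : ∀ i b → toℕ (vertex i b) ≡ 2 * toℕ i ℕ.+ toℕ b
  toℕ-vertex i b = trans (Fin.toℕ-cast (ℕ.*-comm n 2) (Fin.combine i b)) (Fin.toℕ-combine i b)

  ends : Index n → Fin (2 * n) × Fin (2 * n)
  ends (i , Fin.suc j , _) = vertex i Fin.zero , vertex j (Fin.suc Fin.zero)

  edge : ∀ (i j : Fin n) → i Fin.≤ j → Index n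
  edge i j i≤j = i , Fin.suc j , s≤s (ℕ.≤-trans (ℕ.≤-reflexive (Fin.toℕ-inject₁ i)) i≤j)

  graph : List (Index n) → Edges {2 * n}
  graph = map ends

  coordinate : Point n → Fin n → Fin 2 → ℝ
  coordinate v i Fin.zero    = x-coord n v (inject₁ i) -ᴿ y-coord n v i
  coordinate v i (Fin.suc _) = x-coord n v (Fin.suc i)

  label : Point n → Fin (2 * n) → ℝ
  label v = uncurry (coordinate v) ∘ coords

  label-vertex : ∀ v i b → label v (vertex i b) ≡ coordinate v i b
  label-vertex v i b = cong (uncurry (coordinate v)) (coords-vertex i b)

  hyperplane⇒satisfies : ∀ v e → hyperplane n e v → Satisfies ℝ-setoid (label v) (ends e)
  hyperplane⇒satisfies v (i , Fin.suc j , _) h =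
    subst₂ _≈ᴿ_ (sym (label-vertex v i Fin.zero)) (sym (label-vertex v j (Fin.suc Fin.zero)))
      (≈ᴿ-move (x-coord n v (inject₁ i)) (x-coord n v (Fin.suc j)) (y-coord n v i) h)

  satisfies⇒hyperplane : ∀ v e → Satisfies ℝ-setoid (label v) (ends e) → hyperplane n e v
  satisfies⇒hyperplane v (i , Fin.suc j , _) h =
    ≈ᴿ-move (x-coord n v (inject₁ i)) (y-coord n v i) (x-coord n v (Fin.suc j))
      (subst₂ _≈ᴿ_ (label-vertex v i Fin.zero) (label-vertex v j (Fin.suc Fin.zero)) h)

  joined⇒hyperplane : ∀ S e → Joined (graph S) (ends e) → ∀ v → ⋂ n S v → hyperplane n e v
  joined⇒hyperplane S e joined v vS = satisfies⇒hyperplane v e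
    (satisfies-joined ℝ-setoid (label v) (All.map⁺ (All.map (λ {e} → hyperplane⇒satisfies v e) vS)) {ends e} joined)

  module _ (g : Fin (2 * n) → ℝ) where

    private
      xs : Fin (suc n) → ℝ
      xs Fin.zero    = constᴿ (fromℕ 0)
      xs (Fin.suc j) = g (vertex j (Fin.suc Fin.zero))

      ys : Fin n → ℝ
      ys i = xs (inject₁ i) -ᴿ g (vertex i Fin.zero)

    -- A point with prescribed labels. The odd-indexed labels are the coordinates x 1, ..., x n
    -- themselves; x 0 is free and set to 0; each y i is then solved from the label x i - y i.
    labelled : Point n
    labelled = xs Vector.++ ys

    coordinate-labelled : ∀ i b → coordinate labelled i b ≈ᴿ g (vertex i b)
    coordinate-labelled i Fin.zero = pointwise⇒≈ᴿ (coordinate labelled i Fin.zero) (g (vertex i Fin.zero)) λ k → begin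
      approx (x-coord n labelled (inject₁ i) -ᴿ y-coord n labelled i) k
        ≡⟨ cong₂ (λ r s → approx (r -ᴿ s) k) (Vector.lookup-++ˡ xs ys (inject₁ i)) (Vector.lookup-++ʳ xs ys i) ⟩
      approx (xs (inject₁ i)) k ℚ.- (approx (xs (inject₁ i)) k ℚ.- approx (g (vertex i Fin.zero)) k)
        ≡⟨ cancel (approx (xs (inject₁ i)) k) (approx (g (vertex i Fin.zero)) k) ⟩
      approx (g (vertex i Fin.zero)) k ∎
      where
      open ≡-Reasoning
      open ℝ
      open +-*-Solver
      cancel : ∀ p q → p ℚ.- (p ℚ.- q) ≡ q
      cancel = solve 2 (λ p q → p :- (p :- q) := q) refl
    coordinate-labelled i (Fin.suc Fin.zero) = pointwise⇒≈ᴿ (coordinate labelled i (Fin.suc Fin.zero)) (g (vertex i (Fin.suc Fin.zero)))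
      λ k → cong (λ r → ℝ.approx r k) (Vector.lookup-++ˡ xs ys (Fin.suc i))

    label-labelled : ∀ v → label labelled v ≈ᴿ g v
    label-labelled v = subst (label labelled v ≈ᴿ_) (cong g (vertex-coords v))
      (coordinate-labelled (proj₁ (coords v)) (proj₂ (coords v)))

  -- One test point decides: label every vertex by the number of its representative in the graph of
  -- S. This point lies on all hyperplanes in S, and if it also lies on e, then the ends of e have
  -- the same representative.
  hyperplane⇒joined : ∀ S e → (∀ v → ⋂ n S v → hyperplane n e v) → Joined (graph S) (ends e)
  hyperplane⇒joined S e ⋂⊆e = Fin.toℕ-injective (fromℕ-injective (constᴿ-injective (transport (ends e) from-point)))
    where
    r : Fin (2 * n) → Fin (2 * n)
    r = rep (graph S)
    g : Fin (2 * n) → ℝ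
    g v = constᴿ (fromℕ (toℕ (r v)))
    in-⋂S : ⋂ n S (labelled g)
    in-⋂S = All.map (λ {e′} joined → satisfies⇒hyperplane (labelled g) e′ (satisfies (ends e′) joined))
      (All.map⁻ (joined-self (graph S)))
      where
      satisfies : ∀ e → Joined (graph S) e → Satisfies ℝ-setoid (label (labelled g)) e
      satisfies (u , w) eq = begin
        label (labelled g) u ≈⟨ label-labelled g u ⟩
        g u                  ≡⟨ cong (constᴿ ∘ fromℕ ∘ toℕ) eq ⟩
        g w                  ≈⟨ label-labelled g w ⟨
        label (labelled g) w ∎
        where open import Relation.Binary.Reasoning.Setoid ℝ-setoid
    from-point : Satisfies ℝ-setoid (label (labelled g)) (ends e)
    from-point = hyperplane⇒satisfies (labelled g) e (⋂⊆e (labelled g) in-⋂S)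
    transport : ∀ e → Satisfies ℝ-setoid (label (labelled g)) e → Satisfies ℝ-setoid g e
    transport (u , w) h = begin
      g u                  ≈⟨ label-labelled g u ⟨
      label (labelled g) u ≈⟨ h ⟩
      label (labelled g) w ≈⟨ label-labelled g w ⟩
      g w                  ∎
      where open import Relation.Binary.Reasoning.Setoid ℝ-setoid

  -- The order on flats, their enumeration and their rank

  open Poset (ℒ n) using (Carrier; _≈_; module Eq) renaming (_≤_ to _≼_; antisym to ≼-antisym; refl to ≼-refl; reflexive to ≼-reflexive; trans to ≼-trans)
  open PosetProperties (ℒ n) using () renaming (_<_ to _≺_)

  edges : Flat n → Edges {2 * n}
  edges (_ , S , _) = graph S

  -- Together with `joined⇒≼` this turns containment of sets of real points into a decidable
  -- condition on finite graphs; order, rank and enumeration all rest on it.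
  ≼⇒joined : ∀ X Y → X ≼ Y → All (Joined (edges Y)) (edges X)
  ≼⇒joined (X , S , X⊆S , _) (Y , T , _ , T⊆Y) Y⊆X =
    All.map⁺ (All.tabulate λ {e} e∈S → hyperplane⇒joined T e λ v v∈T → All.lookup (X⊆S {v} (Y⊆X {v} (T⊆Y {v} v∈T))) e∈S)

  joined⇒≼ : ∀ X Y → All (Joined (edges Y)) (edges X) → X ≼ Y
  joined⇒≼ (X , S , _ , S⊆X) (Y , T , Y⊆T , _) T⊨S {v} v∈Y =
    S⊆X {v} (All.map (λ {e} joined → joined⇒hyperplane T e joined v (Y⊆T {v} v∈Y)) (All.map⁻ T⊨S))

  _≼?_ : ∀ X Y → Dec (X ≼ Y)
  X ≼? Y = Dec.map′ (joined⇒≼ X Y) (≼⇒joined X Y) (all? (joined? (edges Y)) (edges X))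

  _≈?_ : ∀ X Y → Dec (X ≈ Y)
  _≈?_ = PosetProperties.≤-dec⇒≈-dec (ℒ n) _≼?_

  flat : List (Index n) → Flat n
  flat S = ⋂ n S , S , id , id

  edgesBetween : ∀ i j → Dec (inject₁ i Fin.< j) → List (Index n)
  edgesBetween i j (yes i<j) = (i , j , i<j) ∷ []
  edgesBetween i j (no _)    = []

  abstract
    allEdges : List (Index n)
    allEdges = concatMap (λ i → concatMap (λ j → edgesBetween i j (inject₁ i Fin.<? j)) (allFin (suc n))) (allFin n)

    ∈-allEdges : ∀ e → e ∈ allEdges
    ∈-allEdges (i , j , i<j) = ∈-concatMap⁺ _ (lose (∈-allFin i) (∈-concatMap⁺ (λ j → edgesBetween i j (inject₁ i Fin.<? j)) (lose (∈-allFin j)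
      (∈-edgesBetween (inject₁ i Fin.<? j)))))
      where
      ∈-edgesBetween : ∀ d → (i , j , i<j) ∈ edgesBetween i j d
      ∈-edgesBetween (yes p) = here (cong (λ h → i , j , h) (ℕ.≤-irrelevant i<j p))
      ∈-edgesBetween (no ¬p) = contradiction i<j ¬p

  module _ {q : ℕ} (f : Vec (Fin q) (2 * n)) where

    Monochromatic : Fin (2 * n) × Fin (2 * n) → Set
    Monochromatic = Satisfies (≡.setoid (Fin q)) (Vec.lookup f)

    monochromatic? : ∀ e → Dec (Monochromatic (ends e))
    monochromatic? e = Vec.lookup f (proj₁ (ends e)) Fin.≟ Vec.lookup f (proj₂ (ends e))

    colourFlat : Flat n
    colourFlat = flat (filter monochromatic? allEdges)

    respects-colourFlat : Respects (edges colourFlat) f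
    respects-colourFlat = All.map⁺ (All.all-filter monochromatic? allEdges)

    ≼-colourFlat⁻ : ∀ X → X ≼ colourFlat → Respects (edges X) f
    ≼-colourFlat⁻ X X≼ = All.map
      (λ {e} → satisfies-joined (≡.setoid (Fin q)) (Vec.lookup f) respects-colourFlat {e})
      (≼⇒joined X colourFlat X≼)

    ≼-colourFlat⁺ : ∀ X → Respects (edges X) f → X ≼ colourFlat
    ≼-colourFlat⁺ X@(_ , S , _) fX = joined⇒≼ X colourFlat (All.map⁺ (All.map
      (λ {e} mono → All.lookup (All.map⁻ (joined-self (edges colourFlat))) (∈-filter⁺ monochromatic? (∈-allEdges e) mono))
      (All.map⁻ fX)))

  -- Colour each vertex by its representative: the monochromatic edges are then exactly those joined
  -- in the graph of X. So the finitely many colourings with 2n colours already produce every flat.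
  colourFlat-surjective : ∀ X → X ≈ colourFlat (Vec.tabulate (rep (edges X)))
  colourFlat-surjective X = ≼-antisym {X} {colourFlat f}
    (≼-colourFlat⁺ f X (All.map (λ {e} → lookups e) (joined-self (edges X))))
    (joined⇒≼ (colourFlat f) X (All.map⁺ (All.map (λ {e} → unlookups (ends e)) (All.all-filter (monochromatic? f) allEdges))))
    where
    f : Vec (Fin (2 * n)) (2 * n)
    f = Vec.tabulate (rep (edges X))
    lookups : ∀ e → Joined (edges X) e → Monochromatic f e
    lookups (u , w) eq = trans (Vec.lookup∘tabulate _ u) (trans eq (sym (Vec.lookup∘tabulate _ w)))
    unlookups : ∀ e → Monochromatic f e → Joined (edges X) e
    unlookups (u , w) eq = trans (sym (Vec.lookup∘tabulate _ u)) (trans eq (Vec.lookup∘tabulate _ w))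

  -- The rank in the graphic matroid, that is, the codimension of the flat.
  rank : Flat n → ℕ
  rank X = 2 * n ∸ comps (edges X)

  rank-cong : ∀ {X Y} → X ≈ Y → rank X ≡ rank Y
  rank-cong {X} {Y} X≈Y = cong (2 * n ∸_) (comps-cong (edges X) (edges Y)
    (≼⇒joined Y X (≼-reflexive {Y} {X} (Eq.sym {X} {Y} X≈Y))) (≼⇒joined X Y (≼-reflexive {X} {Y} X≈Y)))

  bottom : Flat n
  bottom = flat []

  bottom-minimum : ∀ X → bottom ≼ X
  bottom-minimum X = joined⇒≼ bottom X []

  rank-bottom : rank bottom ≡ 0
  rank-bottom = trans (cong (2 * n ∸_) (comps-[] {2 * n})) (ℕ.n∸n≡0 (2 * n))

  comps≤ : (E : Edges {2 * n}) → comps E ≤ 2 * n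
  comps≤ E = ℕ.≤-trans (comps-antitone E [] []) (ℕ.≤-reflexive (comps-[] {2 * n}))

  record Between (X Y : Flat n) : Set₁ where
    field
      next      : Flat n
      X≺next    : X ≺ next
      next≼Y    : next ≼ Y
      rank-next : rank next ≡ suc (rank X)

  -- Some hyperplane of Y is not implied by X; adding it to X merges exactly two components and
  -- stays below Y. Both strict monotonicity of the rank and its behaviour at covers follow from
  -- this.
  between : ∀ X Y → X ≺ Y → Between X Y
  between X@(_ , S , _) Y@(_ , T , _) (X≼Y , X≉Y) with All.all? (joined? (edges X) ∘ ends) T
  ... | yes X⊨T = contradiction (≼-antisym {X} {Y} X≼Y (joined⇒≼ Y X (All.map⁺ X⊨T))) X≉Y
  ... | no ¬X⊨T with e , e∈T , ¬joined ← find (All.¬All⇒Any¬ (joined? (edges X) ∘ ends) T ¬X⊨T) = record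
    { next = Z
    ; X≺next = joined⇒≼ X Z (All.tail (joined-self (edges Z))) ,
        λ X≈Z → ¬joined (All.head (≼⇒joined Z X (≼-reflexive {Z} {X} (Eq.sym {X} {Z} X≈Z))))
    ; next≼Y = joined⇒≼ Z Y (All.lookup (All.map⁻ (joined-self (edges Y))) e∈T ∷ ≼⇒joined X Y X≼Y)
    ; rank-next = trans (ℕ.+-∸-assoc 1 (ℕ.≤-trans (ℕ.≤-reflexive drop) (comps≤ (edges X)))) 
        (cong (λ c → suc (2 * n ∸ c)) drop)
    }
    where
    Z : Flat n
    Z = flat (e ∷ S)
    drop : suc (comps (edges Z)) ≡ comps (edges X)
    drop = comps-unjoined (ends e) (edges X) ¬joined

  rank-mono-≼ : ∀ X Y → X ≼ Y → rank X ≤ rank Y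
  rank-mono-≼ X Y X≼Y = ℕ.∸-monoʳ-≤ (2 * n) (comps-antitone (edges Y) (edges X) (≼⇒joined X Y X≼Y))

  rank-mono : ∀ {X Y} → X ≺ Y → rank X ℕ.< rank Y
  rank-mono {X} {Y} X≺Y = ℕ.≤-trans (ℕ.≤-reflexive (sym rank-next)) (rank-mono-≼ next Y next≼Y)
    where open Between (between X Y X≺Y)

  rank-cover : ∀ {X Y} → X ≺ Y × (∀ Z → X ≺ Z → ¬ Z ≺ Y) → rank Y ≡ suc (rank X)
  rank-cover {X} {Y} (X≺Y , cover) = trans (rank-cong {Y} {next} (Eq.sym {next} {Y} next≈Y)) rank-next
    where
    open Between (between X Y X≺Y)
    next≈Y : next ≈ Y
    next≈Y = Dec.decidable-stable (next ≈? Y) λ next≉Y → cover next X≺next (next≼Y , next≉Y)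

  flats : List (Flat n)
  flats = deduplicate _≈?_ (map colourFlat (words (2 * n) (2 * n)))

  flat-decSetoid : DecSetoid (lsuc 0ℓ) 0ℓ
  flat-decSetoid = record { isDecEquivalence = record { isEquivalence = Eq.isEquivalence ; _≟_ = _≈?_ } }

  flats-complete : Enumerates.IsEnumeration Eq.setoid flats
  flats-complete = Enumerates.deduplicate⁺ flat-decSetoid λ X →
    Any.map⁺ (Any.map (λ { refl → colourFlat-surjective X }) (words-complete (Vec.tabulate (rep (edges X)))))

-- Proper colourings as those with trivial flat

module _ {n : ℕ} where

  vertex-up : ∀ i → ¬ Down (vertex {n} i Fin.zero)
  vertex-up i down = >⇒∤ (s≤s (s≤s z≤n)) (∣m+n∣m⇒∣n (subst (2 ∣_) eq down) (m∣m*n (toℕ i)))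
    where
    eq : suc (toℕ (vertex {n} i Fin.zero)) ≡ 2 * toℕ i ℕ.+ 1
    eq = trans (cong suc (toℕ-vertex {n} i Fin.zero)) (sym (ℕ.+-suc (2 * toℕ i) 0))

  vertex-down : ∀ j → Down (vertex {n} j (Fin.suc Fin.zero))
  vertex-down j = subst (2 ∣_) (sym eq) (∣m∣n⇒∣m+n (m∣m*n (toℕ j)) ∣-refl)
    where
    eq : suc (toℕ (vertex {n} j (Fin.suc Fin.zero))) ≡ 2 * toℕ j ℕ.+ 2
    eq = trans (cong suc (toℕ-vertex {n} j (Fin.suc Fin.zero))) (sym (ℕ.+-suc (2 * toℕ j) 1))

  -- In numbers, 2 i < 2 j + 1 if and only if i ≤ j. Hence the pairs in `Proper` are exactly the
  -- edges coming from the hyperplanes.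
  vertex-<⁺ : ∀ {i j} → i Fin.≤ j → vertex {n} i Fin.zero Fin.< vertex {n} j (Fin.suc Fin.zero)
  vertex-<⁺ {i} {j} i≤j rewrite toℕ-vertex {n} i Fin.zero | toℕ-vertex {n} j (Fin.suc Fin.zero)
    | ℕ.+-comm (2 * toℕ j) 1 | ℕ.+-identityʳ (2 * toℕ i) = s≤s (ℕ.*-monoʳ-≤ 2 i≤j)

  vertex-<⁻ : ∀ {i j} → vertex {n} i Fin.zero Fin.< vertex {n} j (Fin.suc Fin.zero) → i Fin.≤ j
  vertex-<⁻ {i} {j} lt rewrite toℕ-vertex {n} i Fin.zero | toℕ-vertex {n} j (Fin.suc Fin.zero)
    | ℕ.+-comm (2 * toℕ j) 1 | ℕ.+-identityʳ (2 * toℕ i) = ℕ.*-cancelˡ-≤ 2 (ℕ.≤-pred lt)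

  module _ {q : ℕ} (f : Vec (Fin q) (2 * n)) where

    proper⇒colourFlat≼bottom : Proper f → Poset._≤_ (ℒ n) (colourFlat f) bottom
    proper⇒colourFlat≼bottom proper {v} = joined⇒≼ (colourFlat f) bottom (All.map⁺ (All.map (λ {e} → impossible e)
      (All.all-filter (monochromatic? f) allEdges))) {v}
      where
      impossible : ∀ e → Monochromatic {n} f (ends e) → Joined [] (ends {n} e)
      impossible (i , Fin.suc j , s≤s i≤j) = λ mono → contradiction mono
        (proper (vertex {n} i Fin.zero) (vertex {n} j (Fin.suc Fin.zero))
          (vertex-up i , vertex-down j , vertex-<⁺ {i} {j} (ℕ.≤-trans (ℕ.≤-reflexive (sym (Fin.toℕ-inject₁ i))) i≤j)))

    colourFlat≼bottom⇒proper : Poset._≤_ (ℒ n) (colourFlat f) bottom → Proper f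
    colourFlat≼bottom⇒proper ≼bottom a b = subst₂ Separated (vertex-coords {n} a) (vertex-coords {n} b)
      (separated (proj₁ (coords {n} a)) (proj₂ (coords {n} a)) (proj₁ (coords {n} b)) (proj₂ (coords {n} b)))
      where
      Separated : Fin (2 * n) → Fin (2 * n) → Set
      Separated a b = ¬ Down a × Down b × a Fin.< b → Vec.lookup f a ≢ Vec.lookup f b
      edgeless : All (λ e → Joined [] (ends e)) (filter (monochromatic? f) allEdges)
      edgeless = All.map⁻ (≼⇒joined (colourFlat f) bottom (λ {v} → ≼bottom {v}))
      separated : ∀ i x j y → Separated (vertex {n} i x) (vertex {n} j y)
      separated i (Fin.suc Fin.zero) j y (¬Da , _) _ = ¬Da (vertex-down i)
      separated i Fin.zero j Fin.zero (_ , Db , _) _ = vertex-up j Db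
      -- In the empty graph every vertex represents itself, so a joined edge would have equal ends.
      separated i Fin.zero j (Fin.suc Fin.zero) (_ , _ , a<b) mono = Fin.<⇒≢ a<b
        (All.lookup edgeless (∈-filter⁺ (monochromatic? f) (∈-allEdges (edge i j (vertex-<⁻ {i} {j} a<b))) mono))

-- The ranked lattice and the comparison of both polynomials

module _ {n : ℕ} where

  private
    m : ℕ
    m = 2 * suc n

  wholeGraph : Edges {m}
  wholeGraph = graph (allEdges {suc n})

  -- The vertex 0 is adjacent to every vertex 2 j + 1, and every vertex 2 i to its successor 2 i +
  -- 1. This is where the length of the lattice drops to one less than the number of vertices.
  connected : ∀ u w → Joined wholeGraph (u , w)
  connected u w = trans (to-origin u) (sym (to-origin w))
    where
    r : Fin m → Fin m
    r = rep wholeGraph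
    joined : ∀ (i j : Fin (suc n)) → i Fin.≤ j → r (vertex {suc n} i Fin.zero) ≡ r (vertex {suc n} j (Fin.suc Fin.zero))
    joined i j i≤j = All.lookup (All.map⁻ {P = Joined wholeGraph} (joined-self wholeGraph)) (∈-allEdges (edge i j i≤j))
    origin : Fin m
    origin = vertex {suc n} Fin.zero Fin.zero
    to-origin′ : ∀ i b → r (vertex {suc n} i b) ≡ r origin
    to-origin′ i Fin.zero           = trans (joined i i ℕ.≤-refl) (sym (joined Fin.zero i z≤n))
    to-origin′ i (Fin.suc Fin.zero) = sym (joined Fin.zero i z≤n)
    to-origin : ∀ v → r v ≡ r origin
    to-origin v = subst (λ x → r x ≡ r origin) (vertex-coords {suc n} v)
      (to-origin′ (proj₁ (coords {suc n} v)) (proj₂ (coords {suc n} v)))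

  top : Flat (suc n)
  top = flat allEdges

  comps-top : comps wholeGraph ≡ 1
  comps-top = comps-connected wholeGraph Fin.zero connected

  X≼top : ∀ X → Poset._≤_ (ℒ (suc n)) X top
  X≼top X = joined⇒≼ X top (All.tabulate λ {e} _ → connected (proj₁ e) (proj₂ e))

  comps-positive : ∀ X → 1 ≤ comps (edges {suc n} X)
  comps-positive X = subst (_≤ comps (edges X)) comps-top
    (comps-antitone (edges top) (edges X) (≼⇒joined X top (X≼top X)))

  rank-top : rank top ≡ m ∸ 1
  rank-top = cong (m ∸_) comps-top

  ℒ-ranked : FiniteRanked (ℒ (suc n)) (m ∸ 1)
  ℒ-ranked = record
    { _≤?_        = _≼?_
    ; elements    = flats
    ; complete    = flats-complete
    ; distinct    = DecSetoidUnique.deduplicate-! flat-decSetoid (map colourFlat (words m m))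
    ; 0̂           = bottom
    ; 0̂-minimum   = bottom-minimum
    ; rk          = rank
    ; rk-cong     = λ {X} {Y} → rank-cong {X = X} {Y}
    ; rk-0̂        = rank-bottom {suc n}
    ; rk-mono     = λ {X} {Y} → rank-mono {X = X} {Y}
    ; rk-cover    = λ {X} {Y} → rank-cover {X = X} {Y}
    ; rk-bounded  = λ X → subst (rank X ≤_) rank-top (rank-mono-≼ X top (X≼top X))
    ; rk-attained = top , rank-top
    }

  open FiniteRanked ℒ-ranked using (μ; χ; 0̂; elements; _≤?_; _≟_)

  -- One double sum over flats X and colourings f constant along the edges of X, read in two ways:
  -- for fixed X it counts colourings, for fixed f it is the Möbius sum below `colourFlat f`.
  ∑-μ-colourings : ∀ q → ∑ elements (λ X → μ 0̂ X ℤ.* + (q ℕ.^ comps (edges X))) ≡ ∑ (words m q) (λ f → 𝟙 (proper? f))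
  ∑-μ-colourings q = begin
    ∑ elements (λ X → μ 0̂ X ℤ.* + (q ℕ.^ comps (edges X)))
      ≡⟨ ∑-cong elements (λ X → cong (μ 0̂ X ℤ.*_) (count-respecting {q = q} (edges X))) ⟨
    ∑ elements (λ X → μ 0̂ X ℤ.* ∑ (words m q) (λ f → 𝟙 (respects? (edges X) f)))
      ≡⟨ ∑-cong elements (λ X → ∑-*ˡ (words m q) (μ 0̂ X) (λ f → 𝟙 (respects? (edges X) f))) ⟨
    ∑ elements (λ X → ∑ (words m q) (λ f → μ 0̂ X ℤ.* 𝟙 (respects? (edges X) f)))
      ≡⟨ ∑-swap elements (words m q) (λ X f → μ 0̂ X ℤ.* 𝟙 (respects? (edges X) f)) ⟩
    ∑ (words m q) (λ f → ∑ elements (λ X → μ 0̂ X ℤ.* 𝟙 (respects? (edges X) f)))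
      ≡⟨ ∑-cong (words m q) (λ f → ∑-cong elements (λ X → trans (ℤ.*-comm (μ 0̂ X) (𝟙 (respects? (edges X) f)))
           (cong (ℤ._* μ 0̂ X) (𝟙-cong (respects? (edges X) f) (X ≤? colourFlat f) (λ h {v} → ≼-colourFlat⁺ f X h {v}) (λ h → ≼-colourFlat⁻ f X (λ {v} → h {v})))))) ⟩
    ∑ (words m q) (λ f → ∑ elements (λ X → 𝟙 (X ≤? colourFlat f) ℤ.* μ 0̂ X))
      ≡⟨ ∑-cong (words m q) (λ f → ∑-μ-below ℒ-ranked (colourFlat f)) ⟩
    ∑ (words m q) (λ f → 𝟙 (colourFlat f ≟ 0̂))
      ≡⟨ ∑-cong (words m q) (λ f → 𝟙-cong (colourFlat f ≟ 0̂) (proper? f)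
           (λ eq → colourFlat≼bottom⇒proper f (λ {v} → Poset.reflexive (ℒ (suc n)) {colourFlat f} {0̂} eq {v}))
           (λ proper → Poset.antisym (ℒ (suc n)) {colourFlat f} {0̂} (λ {v} → proper⇒colourFlat≼bottom f proper {v}) (λ {v} → bottom-minimum (colourFlat f) {v}))) ⟩
    ∑ (words m q) (λ f → 𝟙 (proper? f)) ∎
    where open ≡-Reasoning

  ^-even : -1ℤ ℤ.^ m ≡ 1ℤ
  ^-even = trans (sym (ℤ.^-*-assoc -1ℤ 2 (suc n))) (ℤ.^-zeroˡ (suc n))

  length-dPermutations : ∀ k → + length (dPermutations m k) ≡
    ∑ (words m m) (λ σ → 𝟙 (perm? σ ×-dec isD? σ) ℤ.* 𝟙 (cycles σ ℕ.≟ k))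
  length-dPermutations k = begin
    + length (dPermutations m k)
      ≡⟨ ∑-length (dPermutations m k) ⟨
    ∑ (dPermutations m k) (λ _ → 1ℤ)
      ≡⟨ ∑-filter (λ σ → isD? σ ×-dec (cycles σ ℕ.≟ k)) (permutations m) (λ _ → 1ℤ) ⟩
    ∑ (permutations m) (λ σ → 𝟙 (isD? σ ×-dec (cycles σ ℕ.≟ k)) ℤ.* 1ℤ)
      ≡⟨ ∑-filter perm? (words m m) (λ σ → 𝟙 (isD? σ ×-dec (cycles σ ℕ.≟ k)) ℤ.* 1ℤ) ⟩
    ∑ (words m m) (λ σ → 𝟙 (perm? σ) ℤ.* (𝟙 (isD? σ ×-dec (cycles σ ℕ.≟ k)) ℤ.* 1ℤ))
      ≡⟨ ∑-cong (words m m) regroup ⟩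
    ∑ (words m m) (λ σ → 𝟙 (perm? σ ×-dec isD? σ) ℤ.* 𝟙 (cycles σ ℕ.≟ k)) ∎
    where
    open ≡-Reasoning
    assoc : ∀ i j k → i ℤ.* (j ℤ.* k ℤ.* 1ℤ) ≡ i ℤ.* j ℤ.* k
    assoc = solve-∀
    regroup : ∀ σ → 𝟙 (perm? σ) ℤ.* (𝟙 (isD? σ ×-dec (cycles σ ℕ.≟ k)) ℤ.* 1ℤ) ≡
                    𝟙 (perm? σ ×-dec isD? σ) ℤ.* 𝟙 (cycles σ ℕ.≟ k)
    regroup σ = trans (cong (λ x → 𝟙 (perm? σ) ℤ.* (x ℤ.* 1ℤ)) (𝟙-× (isD? σ) (cycles σ ℕ.≟ k)))
      (trans (assoc (𝟙 (perm? σ)) (𝟙 (isD? σ)) (𝟙 (cycles σ ℕ.≟ k)))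
        (cong (ℤ._* 𝟙 (cycles σ ℕ.≟ k)) (sym (𝟙-× (perm? σ) (isD? σ)))))

  -- Guarantees that the sum over k from 1 to m misses no permutation. The first `refl` holds
  -- because m is a successor and deduplication keeps the head of a list.
  cycles-range : (σ : Vec (Fin m) m) → ∃[ c ] cycles σ ≡ suc c × c ℕ.< m
  cycles-range σ = _ , refl , ℕ.≤-trans (List.length-deduplicate (sameCycle? σ) (allFin m))
    (ℕ.≤-reflexive (List.length-tabulate (id {A = Fin m})))

  ∑-sD : ∀ q → ∑ (upTo m) (λ k → sD m (suc k) ℤ.* + (q ℕ.^ suc k)) ≡
    ∑ (words m m) (λ σ → 𝟙 (perm? σ ×-dec isD? σ) ℤ.* (-1ℤ ℤ.^ cycles σ ℤ.* + (q ℕ.^ cycles σ)))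
  ∑-sD q = begin
    ∑ (upTo m) (λ k → sD m (suc k) ℤ.* + (q ℕ.^ suc k))
      ≡⟨ ∑-cong (upTo m) expand ⟩
    ∑ (upTo m) (λ k → ∑ (words m m) (λ σ → d σ ℤ.* (𝟙 (cycles σ ℕ.≟ suc k) ℤ.* w (suc k))))
      ≡⟨ ∑-swap (upTo m) (words m m) (λ k σ → d σ ℤ.* (𝟙 (cycles σ ℕ.≟ suc k) ℤ.* w (suc k))) ⟩
    ∑ (words m m) (λ σ → ∑ (upTo m) (λ k → d σ ℤ.* (𝟙 (cycles σ ℕ.≟ suc k) ℤ.* w (suc k))))
      ≡⟨ ∑-cong (words m m) (λ σ → trans (∑-*ˡ (upTo m) (d σ) _) (cong (d σ ℤ.*_) (collapse σ))) ⟩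
    ∑ (words m m) (λ σ → d σ ℤ.* w (cycles σ)) ∎
    where
    open ≡-Reasoning
    d : Vec (Fin m) m → ℤ
    d σ = 𝟙 (perm? σ ×-dec isD? σ)
    w : ℕ → ℤ
    w k = -1ℤ ℤ.^ k ℤ.* + (q ℕ.^ k)
    rotate : ∀ i j k → i ℤ.* j ℤ.* k ≡ j ℤ.* (i ℤ.* k)
    rotate = solve-∀
    expand : ∀ k → sD m (suc k) ℤ.* + (q ℕ.^ suc k) ≡
                   ∑ (words m m) (λ σ → d σ ℤ.* (𝟙 (cycles σ ℕ.≟ suc k) ℤ.* w (suc k)))
    expand k = begin
      -1ℤ ℤ.^ suc k ℤ.* + length (dPermutations m (suc k)) ℤ.* + (q ℕ.^ suc k)
        ≡⟨ rotate (-1ℤ ℤ.^ suc k) (+ length (dPermutations m (suc k))) (+ (q ℕ.^ suc k)) ⟩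
      + length (dPermutations m (suc k)) ℤ.* w (suc k)
        ≡⟨ cong (ℤ._* w (suc k)) (length-dPermutations (suc k)) ⟩
      ∑ (words m m) (λ σ → d σ ℤ.* 𝟙 (cycles σ ℕ.≟ suc k)) ℤ.* w (suc k)
        ≡⟨ ∑-*ʳ (words m m) (λ σ → d σ ℤ.* 𝟙 (cycles σ ℕ.≟ suc k)) (w (suc k)) ⟨
      ∑ (words m m) (λ σ → d σ ℤ.* 𝟙 (cycles σ ℕ.≟ suc k) ℤ.* w (suc k))
        ≡⟨ ∑-cong (words m m) (λ σ → ℤ.*-assoc (d σ) (𝟙 (cycles σ ℕ.≟ suc k)) (w (suc k))) ⟩
      ∑ (words m m) (λ σ → d σ ℤ.* (𝟙 (cycles σ ℕ.≟ suc k) ℤ.* w (suc k))) ∎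
    collapse : ∀ σ → ∑ (upTo m) (λ k → 𝟙 (cycles σ ℕ.≟ suc k) ℤ.* w (suc k)) ≡ w (cycles σ)
    collapse σ = let c , c+1≡ , c<m = cycles-range σ in begin
      ∑ (upTo m) (λ k → 𝟙 (cycles σ ℕ.≟ suc k) ℤ.* w (suc k))
        ≡⟨ ∑-cong (upTo m) (λ k → cong (ℤ._* w (suc k)) (𝟙-cong (cycles σ ℕ.≟ suc k) (k ℕ.≟ c)
             (λ eq → ℕ.suc-injective (trans (sym eq) c+1≡)) (λ eq → trans c+1≡ (cong suc (sym eq))))) ⟩
      ∑ (upTo m) (λ k → 𝟙 (k ℕ.≟ c) ℤ.* w (suc k))
        ≡⟨ ∑-δ ℕ._≟_ (Unique.upTo⁺ m) (∈-upTo⁺ c<m) (w ∘ suc) ⟩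
      w (suc c)
        ≡⟨ cong w c+1≡ ⟨
      w (cycles σ) ∎

  χ-D : Polynomial
  χ-D = ∑ᵖ (map (λ k → sD m k ·t^ (k ∸ 1)) (applyUpTo suc m))

  eval-χ-D : ∀ d q → m ≤ d → + q ℤ.* eval d χ-D q ≡ ∑ (upTo m) (λ k → sD m (suc k) ℤ.* + (q ℕ.^ suc k))
  eval-χ-D d q m≤d = begin
    + q ℤ.* eval d χ-D q
      ≡⟨ cong (+ q ℤ.*_) (eval-sum-of-monomials d (applyUpTo suc m) (sD m) (_∸ 1) q
           (All.applyUpTo⁺₁ suc m (λ k<m → ℕ.≤-trans k<m m≤d))) ⟩
    + q ℤ.* ∑ (applyUpTo suc m) (λ k → sD m k ℤ.* + (q ℕ.^ (k ∸ 1)))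
      ≡⟨ cong (λ ks → + q ℤ.* ∑ ks (λ k → sD m k ℤ.* + (q ℕ.^ (k ∸ 1)))) (List.map-upTo suc m) ⟨
    + q ℤ.* ∑ (map suc (upTo m)) (λ k → sD m k ℤ.* + (q ℕ.^ (k ∸ 1)))
      ≡⟨ cong (+ q ℤ.*_) (∑-map suc (upTo m) (λ k → sD m k ℤ.* + (q ℕ.^ (k ∸ 1)))) ⟩
    + q ℤ.* ∑ (upTo m) (λ k → sD m (suc k) ℤ.* + (q ℕ.^ k))
      ≡⟨ ∑-*ˡ (upTo m) (+ q) (λ k → sD m (suc k) ℤ.* + (q ℕ.^ k)) ⟨
    ∑ (upTo m) (λ k → + q ℤ.* (sD m (suc k) ℤ.* + (q ℕ.^ k)))
      ≡⟨ ∑-cong (upTo m) (λ k → raise q (sD m (suc k)) k) ⟩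
    ∑ (upTo m) (λ k → sD m (suc k) ℤ.* + (q ℕ.^ suc k)) ∎
    where open ≡-Reasoning

  -- The length m - 1 makes the exponent at X one less than its number of components, and the factor
  -- q makes up for it. With truncated subtraction this needs that number to lie between 1 and m.
  eval-χ : ∀ d q → m ≤ d → + q ℤ.* eval d χ q ≡ ∑ elements (λ X → μ 0̂ X ℤ.* + (q ℕ.^ comps (edges X)))
  eval-χ d q m≤d = begin
    + q ℤ.* eval d χ q
      ≡⟨ cong (+ q ℤ.*_) (eval-sum-of-monomials d elements (μ 0̂) (λ X → m ∸ 1 ∸ rank X) q
           (All.tabulate λ {X} _ → ℕ.≤-trans (s≤s (ℕ.m∸n≤m (m ∸ 1) (rank X))) m≤d)) ⟩
    + q ℤ.* ∑ elements (λ X → μ 0̂ X ℤ.* + (q ℕ.^ (m ∸ 1 ∸ rank X)))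
      ≡⟨ ∑-*ˡ elements (+ q) (λ X → μ 0̂ X ℤ.* + (q ℕ.^ (m ∸ 1 ∸ rank X))) ⟨
    ∑ elements (λ X → + q ℤ.* (μ 0̂ X ℤ.* + (q ℕ.^ (m ∸ 1 ∸ rank X))))
      ≡⟨ ∑-cong elements (λ X → trans (raise q (μ 0̂ X) (m ∸ 1 ∸ rank X))
           (cong (λ e → μ 0̂ X ℤ.* + (q ℕ.^ e)) (corank X))) ⟩
    ∑ elements (λ X → μ 0̂ X ℤ.* + (q ℕ.^ comps (edges X))) ∎
    where
    open ≡-Reasoning
    corank′ : ∀ {l c} → 1 ≤ c → c ≤ suc l → suc (l ∸ (suc l ∸ c)) ≡ c
    corank′ {l} {suc c} _ (s≤s c≤l) = cong suc (ℕ.m∸[m∸n]≡n c≤l)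
    corank : ∀ X → suc (m ∸ 1 ∸ rank X) ≡ comps (edges X)
    corank X = corank′ (comps-positive X) (comps≤ {suc n} (edges X))

  χ≗χ-D : χ ≗ χ-D
  χ≗χ-D k = eval-injective d χ χ-D (λ q → ℤ.*-cancelˡ-≡ (+ suc q) _ _ (begin
    + suc q ℤ.* eval d χ (suc q)
      ≡⟨ eval-χ d (suc q) m≤d ⟩
    ∑ elements (λ X → μ 0̂ X ℤ.* + (suc q ℕ.^ comps (edges X)))
      ≡⟨ ∑-μ-colourings (suc q) ⟩
    ∑ (words m (suc q)) (λ f → 𝟙 (proper? f))
      ≡⟨ count-proper {m} (suc q) ^-even ⟩
    ∑ (words m m) (λ σ → 𝟙 (perm? σ ×-dec isD? σ) ℤ.* (-1ℤ ℤ.^ cycles σ ℤ.* + (suc q ℕ.^ cycles σ)))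
      ≡⟨ ∑-sD (suc q) ⟨
    ∑ (upTo m) (λ k → sD m (suc k) ℤ.* + (suc q ℕ.^ suc k))
      ≡⟨ eval-χ-D d (suc q) m≤d ⟨
    + suc q ℤ.* eval d χ-D (suc q) ∎)) k (ℕ.m≤m+n (suc k) m)
    where
    open ≡-Reasoning
    d : ℕ
    -- Large enough to include the coefficient k and every exponent occurring in either polynomial,
    -- all of which are below m.
    d = suc k ℕ.+ m
    m≤d : m ≤ d
    m≤d = ℕ.m≤n+m m (suc k)

corollary4p11 : (n : ℕ) → 1 ≤ n →
    Σ[ P ∈ FiniteRanked (ℒ n) (2 * n ∸ 1) ]
    (FiniteRanked.χ P ≗ ∑ᵖ (map (λ k → sD (2 * n) k ·t^ (k ∸ 1)) (applyUpTo suc (2 * n))))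
corollary4p11 (suc n) _ = ℒ-ranked {n} , χ≗χ-D {n}
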